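{- For every $\varepsilon>0$ there is a constant $C_\varepsilon>0$ such that for every integer $n\ge 1$ there exist a positive integer $k\le C_\varepsilon\, n^{1/2}$ and a $\mathrm{MAJ}_k\circ\mathrm{MAJ}_k$ circuit $C$ on the variables $x_1,\dots,x_n$ such that $C(A)=\mathrm{MAJ}_n(A)$ for at least a $(1-\varepsilon)$ fraction of all $A\in\{0,1\}^n$.
   Context: $\mathrm{MAJ}_n(x_1,\dots,x_n)=1$ if $\sum_{i=1}^n x_i\ge n/2$, and $0$ otherwise. For a positive integer $k$, a $\mathrm{MAJ}_k\circ\mathrm{MAJ}_k$ circuit on $x_1,\dots,x_n$ is a depth two formula with a single top gate whose inputs are bottom-level gates, the inputs of each bottom-level gate being variables among $x_1,\dots,x_n$. Every gate (top and bottom) is a threshold gate: with inputs $z_1,\dots,z_r$ it outputs $1$ if $\sum_i c_i z_i\ge t$ and $0$ otherwise, where the weights $c_i$ are positive integers with $\sum_i c_i\le k$ and $t$ is an arbitrary integer threshold (weights and thresholds may differ from gate to gate). A weight $c_i$ can equivalently be seen as repeating the input $z_i$ $c_i$ times. -}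

module Defs where

open import Data.Bool using (Bool; true; false; if_then_else_)
import Data.Bool.Properties as Bool
open import Data.Fin using (Fin)
open import Data.Integer as ℤ using (ℤ; +_)
open import Data.List as List using (List)
open import Data.Nat as ℕ using (ℕ; zero; suc)
open import Data.Nat.Properties using (m^n≢0)
open import Data.Rational as ℚ using (ℚ)
open import Data.Vec as Vec using (Vec; []; _∷_)
open import Data.Vec.Relation.Unary.All using (All)
open import Relation.Nullary.Decidable using (⌊_⌋)

bit : Bool → ℕ
bit b = if b then 1 else 0

-- The condition Σ xᵢ ≥ n/2 is written n ≤ 2 · Σ xᵢ.
MAJ : ∀ {n} → Vec Bool n → Bool
MAJ {n} A = ⌊ n ℕ.≤? 2 ℕ.* Vec.sum (Vec.map bit A) ⌋

-- I is the type of possible inputs of the gate. The same input may be listed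
-- several times, which amounts to adding up its weights.
record Gate (k : ℕ) (I : Set) : Set where
  constructor gate
  field
    {fanIn}   : ℕ
    inputs    : Vec I fanIn
    weights   : Vec ℕ fanIn
    positive  : All (1 ℕ.≤_) weights
    bounded   : Vec.sum weights ℕ.≤ k
    threshold : ℤ

open Gate public

evalGate : ∀ {k I} → Gate k I → (I → Bool) → Bool
evalGate g val =
  ⌊ threshold g ℤ.≤? + Vec.sum (Vec.zipWith ℕ._*_ (weights g) (Vec.map (λ i → bit (val i)) (inputs g))) ⌋

MAJ∘MAJ : (k n : ℕ) → Set
MAJ∘MAJ k n = Gate k (Gate k (Fin n))

eval : ∀ {k n} → MAJ∘MAJ k n → Vec Bool n → Bool
eval C A = evalGate C (λ g → evalGate g (Vec.lookup A))

cube : ∀ n → List (Vec Bool n)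
cube zero    = List.[ [] ]
cube (suc n) = List.cartesianProductWith _∷_ (false List.∷ true List.∷ List.[]) (cube n)

agreements : ∀ {n} → (f g : Vec Bool n → Bool) → ℕ
agreements {n} f g = List.length (List.filter (λ A → f A Bool.≟ g A) (cube n))

agreementFraction : ∀ {n} → (f g : Vec Bool n → Bool) → ℚ
agreementFraction {n} f g = ℚ._/_ (+ agreements f g) (2 ℕ.^ n) {{m^n≢0 2 n}}

-- k ≤ c · n^{1/2}, squared; the two are equivalent for c ≥ 0.
infix 4 _≤_·√_
_≤_·√_ : ℕ → ℚ → ℕ → Set
k ≤ c ·√ n = (+ (k ℕ.* k) ℚ./ 1) ℚ.≤ (c ℚ.* c) ℚ.* (+ n ℚ./ 1)

{-# OPTIONS --safe #-}
-- Cut the variables into about √n blocks of size at most p = T d² ~ √n and write the excess X = 2 Σ xᵢ − n as the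
-- sum of the block excesses. For each block the 2T bottom gates with thresholds ± j d (1 ≤ j ≤ T) round the block
-- excess to a multiple of d, truncated to [−T d, T d], and the top gate tests the sign of the sum G of the rounded
-- values. Rounding is odd, so the rounding errors are independent and centred; by the fourth moment bound
-- E x⁴ ≤ 3 p² each has second moment at most 4 d², and the total error H = X − d G has E H² ≤ 4 p d². A disagreement
-- with MAJ forces ∣ H ∣ ≥ ∣ X ∣, hence ∣ X ∣ < L or ∣ H ∣ ≥ L for any L. The first event has probability O(L / √n),
-- since every binomial coefficient is at most 2ⁿ / √n, and the second at most 4 p d² / L² by Chebyshev.
-- If n is so small that d = 1, nothing is rounded and the circuit is exact.
module Submission where

open import Defs
open import Data.Bool using (Bool; true; false; not)
import Data.List as List
import Data.List.Properties as List
open import Data.Nat as ℕ using (ℕ; zero; suc)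
import Data.Nat.Properties as ℕ
open import Data.Nat.Combinatorics using (_C_; k>n⇒nCk≡0; nC1≡n; nCk+nC[k+1]≡[n+1]C[k+1])
import Data.Nat.Tactic.RingSolver as ℕ-Ring
open import Data.Integer as ℤ using (ℤ)
import Data.Integer.Properties as ℤ
import Data.Integer.Tactic.RingSolver as ℤ-Ring
open import Data.Vec as Vec using (Vec; []; _∷_; take; drop)
open import Data.Product using (_×_; _,_; proj₂; ∃-syntax; Σ-syntax)
open import Data.Sum as Sum using (_⊎_; inj₁; inj₂)
open import Function using (_∘_; id)
open import Relation.Nullary using (¬_; Dec; yes; no; does; contradiction)
open import Relation.Nullary.Decidable using (⌊_⌋; does-⇔; isYes≗does)
open import Relation.Unary using (Pred; Decidable)
open import Relation.Binary.PropositionalEquality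
open import Data.Fin using (Fin; _↑ˡ_; _↑ʳ_) renaming (zero to fzero; suc to fsuc)
open import Data.Vec.Relation.Unary.All using (All; []; _∷_)
import Data.Vec.Properties as Vec
open import Function.Bundles using (_⇔_; mk⇔)
open import Data.Nat.DivMod using (_/_; m*n/n≡m)
import Data.Bool.Properties as Bool
import Data.Rational as ℚ
import Data.Rational.Properties as ℚ
import Data.Rational.Unnormalised as ℚᵘ
import Data.Rational.Unnormalised.Properties as ℚᵘ
import Data.Nat.Coprimality as Coprimality

-- Binomial coefficients

module _ where
  open import Data.Nat using (_+_; _*_; _^_; _≤_; s≤s; z≤n; >-nonZero)
  open import Data.Nat.Properties

  private
    -- The inductive step of `C-absorption` over abstract numbers. Here `x`, `y`, `z`, `w` stand for
    -- `suc n C suc k`, `suc n C suc (suc k)`, `n C k` and `n C suc k`, and the last hypothesis is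
    -- Pascal's rule.
    absorption-step : ∀ n k x y z w → suc k * x ≡ suc n * z → suc (suc k) * y ≡ suc n * w → z + w ≡ x →
                      suc (suc k) * (x + y) ≡ suc (suc n) * x
    absorption-step n k x y z w p q r = begin
      suc (suc k) * (x + y)                     ≡⟨ e₁ k x y ⟩
      x + (suc k * x + suc (suc k) * y)         ≡⟨ cong (x +_) (cong₂ _+_ p q) ⟩
      x + (suc n * z + suc n * w)               ≡⟨ e₂ n x z w ⟩
      x + suc n * (z + w)                       ≡⟨ cong (λ v → x + suc n * v) r ⟩
      x + suc n * x                             ∎
      where
      open ≡-Reasoning
      e₁ : ∀ k x y → suc (suc k) * (x + y) ≡ x + (suc k * x + suc (suc k) * y)
      e₁ = ℕ-Ring.solve-∀
      e₂ : ∀ n x z w → x + (suc n * z + suc n * w) ≡ x + suc n * (z + w)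
      e₂ = ℕ-Ring.solve-∀

  C-absorption : ∀ n k → suc k * (suc n C suc k) ≡ suc n * (n C k)
  C-absorption zero zero = refl
  C-absorption zero (suc k) = trans
    (cong (suc (suc k) *_) (k>n⇒nCk≡0 {1} {suc (suc k)} (s≤s (s≤s z≤n))))
    (trans (*-zeroʳ (suc (suc k))) (sym (cong (1 *_) (k>n⇒nCk≡0 {0} {suc k} (s≤s z≤n)))))
  C-absorption (suc n) zero = trans (+-identityʳ _) (trans (nC1≡n (suc (suc n))) (sym (*-identityʳ _)))
  C-absorption (suc n) (suc k) = begin
    suc (suc k) * (suc (suc n) C suc (suc k))
      ≡⟨ cong (suc (suc k) *_) (nCk+nC[k+1]≡[n+1]C[k+1] (suc n) (suc k)) ⟨
    suc (suc k) * ((suc n C suc k) + (suc n C suc (suc k)))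
      ≡⟨ absorption-step n k _ _ _ _ (C-absorption n k) (C-absorption n (suc k)) (nCk+nC[k+1]≡[n+1]C[k+1] n k) ⟩
    suc (suc n) * (suc n C suc k) ∎
    where open ≡-Reasoning

  -- A subtraction-free form of (n + 1 - k) C(n + 1, k) = (n + 1) C(n, k): multiply Pascal's rule by
  -- n + 1 and rewrite one summand by absorption.
  C-coabsorption : ∀ n k → suc n * (suc n C k) ≡ k * (suc n C k) + suc n * (n C k)
  C-coabsorption n zero = refl
  C-coabsorption n (suc k) = begin
    suc n * (suc n C suc k)                              ≡⟨ cong (suc n *_) (nCk+nC[k+1]≡[n+1]C[k+1] n k) ⟨
    suc n * ((n C k) + (n C suc k))                      ≡⟨ *-distribˡ-+ (suc n) (n C k) _ ⟩
    suc n * (n C k) + suc n * (n C suc k)                ≡⟨ cong (_+ suc n * (n C suc k)) (C-absorption n k) ⟨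
    suc k * (suc n C suc k) + suc n * (n C suc k)        ∎
    where open ≡-Reasoning

  -- The double factorials (2m)!! and (2m - 1)!!. The ratio `odds m` / `evens m` is the central
  -- binomial coefficient C(2m, m) divided by 4ᵐ.
  evens odds : ℕ → ℕ
  evens zero    = 1
  evens (suc m) = suc m * 2 * evens m
  odds zero    = 1
  odds (suc m) = suc (m * 2) * odds m

  evens>0 : ∀ m → 1 ≤ evens m
  evens>0 zero    = ≤-refl
  evens>0 (suc m) = *-mono-≤ {1} {suc m * 2} (s≤s z≤n) (evens>0 m)

  -- The Wallis estimate. The induction rests on (2m + 3)(2m + 1) + 1 = (2m + 2)².
  odds²≤evens² : ∀ m → suc (m * 2) * (odds m * odds m) ≤ evens m * evens m
  odds²≤evens² zero    = ≤-refl
  odds²≤evens² (suc m) = begin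
    suc (suc m * 2) * (suc (m * 2) * odds m * (suc (m * 2) * odds m))  ≡⟨ e₁ m (odds m) ⟩
    suc (suc m * 2) * suc (m * 2) * (suc (m * 2) * (odds m * odds m))  ≤⟨ *-monoʳ-≤ (suc (suc m * 2) * suc (m * 2)) (odds²≤evens² m) ⟩
    suc (suc m * 2) * suc (m * 2) * (evens m * evens m)                ≤⟨ m≤n+m _ (evens m * evens m) ⟩
    evens m * evens m + suc (suc m * 2) * suc (m * 2) * (evens m * evens m) ≡⟨ e₂ m (evens m) ⟩
    suc m * 2 * evens m * (suc m * 2 * evens m)                        ∎
    where
    open ≤-Reasoning
    e₁ : ∀ m o → suc (suc m * 2) * (suc (m * 2) * o * (suc (m * 2) * o)) ≡ suc (suc m * 2) * suc (m * 2) * (suc (m * 2) * (o * o))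
    e₁ = ℕ-Ring.solve-∀
    e₂ : ∀ m e → e * e + suc (suc m * 2) * suc (m * 2) * (e * e) ≡ suc m * 2 * e * (suc m * 2 * e)
    e₂ = ℕ-Ring.solve-∀

  -- By Pascal's rule a bound uniform along one row doubles in the next, at the same rate as 2ⁿ. The
  -- factor `P` carries a denominator.
  C-pascal-≤ : ∀ n k B P → (∀ j → (n C j) * P ≤ B) → (suc n C k) * P ≤ 2 * B
  C-pascal-≤ n zero B P bound = ≤-trans (bound 0) (m≤m+n B _)
  C-pascal-≤ n (suc k) B P bound = begin
    (suc n C suc k) * P               ≡⟨ cong (_* P) (nCk+nC[k+1]≡[n+1]C[k+1] n k) ⟨
    ((n C k) + (n C suc k)) * P       ≡⟨ *-distribʳ-+ P (n C k) _ ⟩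
    (n C k) * P + (n C suc k) * P     ≤⟨ +-mono-≤ (bound k) (bound (suc k)) ⟩
    B + B                             ≡⟨ cong (B +_) (+-identityʳ B) ⟨
    2 * B                             ∎
    where open ≤-Reasoning

  -- Passing from row 2m to row 2m + 1 costs only (2m + 1)/(m + 1), slightly less than 2. In the
  -- left half this comes from coabsorption with 2m + 1 - k ≥ m + 1, in the right half from
  -- absorption, where the lower index is at least m + 1.
  C-odd-≤ : ∀ m k → ∃[ j ] suc m * (suc (m * 2) C k) ≤ suc (m * 2) * (m * 2 C j)
  C-odd-≤ m k with k ≤? m
  ... | yes k≤m = k , +-cancelˡ-≤ (m * N) _ _ (begin
      m * N + suc m * N                    ≡⟨ e m N ⟩
      suc (m * 2) * N                      ≡⟨ C-coabsorption (m * 2) k ⟩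
      k * N + suc (m * 2) * (m * 2 C k)    ≤⟨ +-monoˡ-≤ _ (*-monoˡ-≤ N k≤m) ⟩
      m * N + suc (m * 2) * (m * 2 C k)    ∎)
    where
    open ≤-Reasoning
    N = suc (m * 2) C k
    e : ∀ m N → m * N + suc m * N ≡ suc (m * 2) * N
    e = ℕ-Ring.solve-∀
  C-odd-≤ m zero    | no k≰m = contradiction z≤n k≰m
  C-odd-≤ m (suc k) | no k≰m = k , (begin
      suc m * N                     ≤⟨ *-monoˡ-≤ N (≰⇒> k≰m) ⟩
      suc k * N                     ≡⟨ C-absorption (m * 2) k ⟩
      suc (m * 2) * (m * 2 C k)     ∎)
    where
    open ≤-Reasoning
    N = suc (m * 2) C suc k

  -- The induction advances two rows at a time: `C-odd-≤` contributes (2m + 1)/(m + 1) and Pascal's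
  -- rule 2. The product 4 (2m + 1)/(2m + 2) is exactly the growth of 4ᵐ `odds m` / `evens m`.
  C-even-bound : ∀ m k → (m * 2 C k) * evens m ≤ 2 ^ (m * 2) * odds m
  C-even-bound zero zero    = ≤-refl
  C-even-bound zero (suc k) rewrite k>n⇒nCk≡0 {0} {suc k} (s≤s z≤n) = z≤n
  C-even-bound (suc m) k = begin
    (suc m * 2 C k) * (suc m * 2 * evens m)                       ≡⟨ e₁ (suc m * 2 C k) m (evens m) ⟩
    2 * ((suc m * 2 C k) * (suc m * evens m))                     ≤⟨ *-monoʳ-≤ 2 (C-pascal-≤ (suc (m * 2)) k _ (suc m * evens m) odd) ⟩
    2 * (2 * (suc (m * 2) * (2 ^ (m * 2) * odds m)))              ≡⟨ e₂ m (2 ^ (m * 2)) (odds m) ⟩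
    2 ^ (suc m * 2) * odds (suc m)                                ∎
    where
    open ≤-Reasoning
    e₁ : ∀ x m e → x * (suc m * 2 * e) ≡ 2 * (x * (suc m * e))
    e₁ = ℕ-Ring.solve-∀
    e₂ : ∀ m q o → 2 * (2 * (suc (m * 2) * (q * o))) ≡ 2 * (2 * q) * (suc (m * 2) * o)
    e₂ = ℕ-Ring.solve-∀
    e₃ : ∀ x m e → x * (suc m * e) ≡ suc m * x * e
    e₃ = ℕ-Ring.solve-∀
    odd : ∀ j → (suc (m * 2) C j) * (suc m * evens m) ≤ suc (m * 2) * (2 ^ (m * 2) * odds m)
    odd j with i , le ← C-odd-≤ m j = begin
      (suc (m * 2) C j) * (suc m * evens m)     ≡⟨ e₃ (suc (m * 2) C j) m (evens m) ⟩
      suc m * (suc (m * 2) C j) * evens m       ≤⟨ *-monoˡ-≤ (evens m) le ⟩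
      suc (m * 2) * (m * 2 C i) * evens m       ≡⟨ *-assoc (suc (m * 2)) (m * 2 C i) _ ⟩
      suc (m * 2) * ((m * 2 C i) * evens m)     ≤⟨ *-monoʳ-≤ (suc (m * 2)) (C-even-bound m i) ⟩
      suc (m * 2) * (2 ^ (m * 2) * odds m)      ∎

  C-odd-bound : ∀ m k → (suc (m * 2) C k) * evens m ≤ 2 ^ suc (m * 2) * odds m
  C-odd-bound m k = ≤-trans (C-pascal-≤ (m * 2) k _ (evens m) (C-even-bound m)) (≤-reflexive (sym (*-assoc 2 (2 ^ (m * 2)) (odds m))))

  square-cancel-≤ : ∀ x y → x * x ≤ y * y → x ≤ y
  square-cancel-≤ x y p with x ≤? y
  ... | yes x≤y = x≤y
  ... | no x≰y = contradiction p (<⇒≱ (*-mono-< (≰⇒> x≰y) (≰⇒> x≰y)))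
   

  -- Squaring brings in `odds²≤evens²`: the factor 2m + 1 absorbs s², and both the square and
  -- `evens m` cancel.
  wallis-cancel : ∀ m s x y → s * s ≤ suc (m * 2) → x * evens m ≤ y * odds m → s * x ≤ y
  wallis-cancel m s x y s² bound = *-cancelʳ-≤ (s * x) y (evens m) ⦃ >-nonZero (evens>0 m) ⦄ (square-cancel-≤ _ _ (begin
    s * x * evens m * (s * x * evens m)            ≡⟨ e₁ s x (evens m) ⟩
    s * s * (x * evens m * (x * evens m))          ≤⟨ *-mono-≤ s² (*-mono-≤ bound bound) ⟩
    suc (m * 2) * (y * odds m * (y * odds m))      ≡⟨ e₂ (suc (m * 2)) y (odds m) ⟩
    y * y * (suc (m * 2) * (odds m * odds m))      ≤⟨ *-monoʳ-≤ (y * y) (odds²≤evens² m) ⟩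
    y * y * (evens m * evens m)                    ≡⟨ e₃ y (evens m) ⟩
    y * evens m * (y * evens m)                    ∎))
    where
    open ≤-Reasoning
    e₁ : ∀ s x e → s * x * e * (s * x * e) ≡ s * s * (x * e * (x * e))
    e₁ = ℕ-Ring.solve-∀
    e₂ : ∀ c y o → c * (y * o * (y * o)) ≡ y * y * (c * (o * o))
    e₂ = ℕ-Ring.solve-∀
    e₃ : ∀ y e → y * y * (e * e) ≡ y * e * (y * e)
    e₃ = ℕ-Ring.solve-∀

  parity : ∀ n → ∃[ m ] (n ≡ m * 2 ⊎ n ≡ suc (m * 2))
  parity zero = 0 , inj₁ refl
  parity (suc n) with parity n
  ... | m , inj₁ refl = m , inj₂ refl
  ... | m , inj₂ refl = suc m , inj₁ refl

  -- The integer `s` stands in for √n. For even n = 2m the hypothesis is weakened to s² ≤ 2m + 1, so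
  -- that both parities use the same cancellation.
  C-anticoncentration : ∀ n k s → s * s ≤ n → s * (n C k) ≤ 2 ^ n
  C-anticoncentration n k s s² with parity n
  ... | m , inj₁ refl = wallis-cancel m s _ _ (≤-trans s² (n≤1+n _)) (C-even-bound m k)
  ... | m , inj₂ refl = wallis-cancel m s _ _ s² (C-odd-bound m k)

-- Sums over the cube and moments of the excess

module _ where
  open import Data.Integer using (+_; -_; _+_; _-_; _*_; _≤_; 0ℤ; 1ℤ; -1ℤ; ∣_∣)

  ⟦_⟧ : Bool → ℤ
  ⟦ b ⟧ = + bit b

  -- Recursion on the two halves of the cube, rather than a sum over the list `cube`, makes
  -- linearity and the splitting of coordinates plain inductions; `length-filter-cube` links it to
  -- the counts in `agreements`.
  ∑ : ∀ {n} → (Vec Bool n → ℤ) → ℤ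
  ∑ {zero}  F = F []
  ∑ {suc n} F = ∑ (λ A → F (false ∷ A)) + ∑ (λ A → F (true ∷ A))

  ∑-cong : ∀ n {F G : Vec Bool n → ℤ} → F ≗ G → ∑ F ≡ ∑ G
  ∑-cong zero  F≗G = F≗G []
  ∑-cong (suc n) F≗G = cong₂ _+_ (∑-cong n (F≗G ∘ (false ∷_))) (∑-cong n (F≗G ∘ (true ∷_)))

  ∑-mono : ∀ n {F G : Vec Bool n → ℤ} → (∀ A → F A ≤ G A) → ∑ F ≤ ∑ G
  ∑-mono zero  F≤G = F≤G []
  ∑-mono (suc n) F≤G = ℤ.+-mono-≤ (∑-mono n (F≤G ∘ (false ∷_))) (∑-mono n (F≤G ∘ (true ∷_)))

  ∑-+ : ∀ n (F G : Vec Bool n → ℤ) → ∑ (λ A → F A + G A) ≡ ∑ F + ∑ G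
  ∑-+ zero  F G = refl
  ∑-+ (suc n) F G = trans (cong₂ _+_ (∑-+ n _ _) (∑-+ n _ _))
    (interchange (∑ (F ∘ (false ∷_))) (∑ (G ∘ (false ∷_))) (∑ (F ∘ (true ∷_))) (∑ (G ∘ (true ∷_))))
    where
    interchange : ∀ a b c d → (a + b) + (c + d) ≡ (a + c) + (b + d)
    interchange = ℤ-Ring.solve-∀

  ∑-* : ∀ n c (F : Vec Bool n → ℤ) → ∑ (λ A → c * F A) ≡ c * ∑ F
  ∑-* zero  c F = refl
  ∑-* (suc n) c F = trans (cong₂ _+_ (∑-* n c _) (∑-* n c _))
    (sym (ℤ.*-distribˡ-+ c (∑ (F ∘ (false ∷_))) (∑ (F ∘ (true ∷_)))))

  ∑-const : ∀ n c → ∑ {n} (λ _ → c) ≡ + (2 ℕ.^ n) * c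
  ∑-const zero    c = sym (ℤ.*-identityˡ c)
  ∑-const (suc n) c = begin
    ∑ {n} (λ _ → c) + ∑ {n} (λ _ → c)          ≡⟨ cong₂ _+_ (∑-const n c) (∑-const n c) ⟩
    + (2 ℕ.^ n) * c + + (2 ℕ.^ n) * c          ≡⟨ double (+ (2 ℕ.^ n)) c ⟩
    + 2 * + (2 ℕ.^ n) * c                      ≡⟨ cong (_* c) (ℤ.pos-* 2 (2 ℕ.^ n)) ⟨
    + (2 ℕ.^ suc n) * c                        ∎
    where
    open ≡-Reasoning
    double : ∀ q c → q * c + q * c ≡ + 2 * q * c
    double = ℤ-Ring.solve-∀

  ∑-neg : ∀ n (F : Vec Bool n → ℤ) → ∑ (λ A → - F A) ≡ - ∑ F
  ∑-neg zero  F = refl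
  ∑-neg (suc n) F = trans (cong₂ _+_ (∑-neg n _) (∑-neg n _))
    (sym (ℤ.neg-distrib-+ (∑ (F ∘ (false ∷_))) (∑ (F ∘ (true ∷_)))))

  ∑-complement : ∀ n (F : Vec Bool n → ℤ) → ∑ (F ∘ Vec.map not) ≡ ∑ F
  ∑-complement zero  F = refl
  ∑-complement (suc n) F = trans (cong₂ _+_ (∑-complement n _) (∑-complement n _))
    (ℤ.+-comm (∑ (F ∘ (true ∷_))) (∑ (F ∘ (false ∷_))))

  -- Fubini for a product of two cubes. It expresses the independence of disjoint blocks.
  ∑-split : ∀ q {n} (F : Vec Bool q → Vec Bool n → ℤ) →
            ∑ (λ A → F (take q A) (drop q A)) ≡ ∑ (λ u → ∑ (F u))
  ∑-split zero    F = refl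
  ∑-split (suc q) F = cong₂ _+_ (∑-split q (F ∘ (false ∷_))) (∑-split q (F ∘ (true ∷_)))

  length-filter-map : ∀ {a b p} {A : Set a} {B : Set b} {P : Pred B p} (P? : Decidable P) (f : A → B) xs →
                      List.length (List.filter P? (List.map f xs)) ≡ List.length (List.filter (P? ∘ f) xs)
  length-filter-map P? f List.[]       = refl
  length-filter-map P? f (x List.∷ xs) with does (P? (f x))
  ... | true  = cong suc (length-filter-map P? f xs)
  ... | false = length-filter-map P? f xs

  length-filter-cube : ∀ {n p} {P : Pred (Vec Bool n) p} (P? : Decidable P) →
                       + List.length (List.filter P? (cube n)) ≡ ∑ (λ A → ⟦ ⌊ P? A ⌋ ⟧)
  length-filter-cube {zero} P? with P? []
  ... | yes _ = refl
  ... | no _  = refl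
  length-filter-cube {suc n} P? = begin
    + List.length (List.filter P? (List.map (false ∷_) (cube n) List.++ (List.map (true ∷_) (cube n) List.++ List.[])))
      ≡⟨ cong (λ xs → + List.length (List.filter P? (List.map (false ∷_) (cube n) List.++ xs))) (List.++-identityʳ _) ⟩
    + List.length (List.filter P? (List.map (false ∷_) (cube n) List.++ List.map (true ∷_) (cube n)))
      ≡⟨ cong (λ xs → + List.length xs) (List.filter-++ P? (List.map (false ∷_) (cube n)) _) ⟩
    + List.length (List.filter P? (List.map (false ∷_) (cube n)) List.++ List.filter P? (List.map (true ∷_) (cube n)))
      ≡⟨ cong +_ (List.length-++ (List.filter P? (List.map (false ∷_) (cube n)))) ⟩
    + (List.length (List.filter P? (List.map (false ∷_) (cube n))) ℕ.+ List.length (List.filter P? (List.map (true ∷_) (cube n))))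
      ≡⟨ cong₂ (λ a b → + (a ℕ.+ b)) (length-filter-map P? (false ∷_) (cube n)) (length-filter-map P? (true ∷_) (cube n)) ⟩
    + List.length (List.filter (P? ∘ (false ∷_)) (cube n)) + + List.length (List.filter (P? ∘ (true ∷_)) (cube n))
      ≡⟨ cong₂ _+_ (length-filter-cube (P? ∘ (false ∷_))) (length-filter-cube (P? ∘ (true ∷_))) ⟩
    ∑ (λ A → ⟦ ⌊ P? A ⌋ ⟧) ∎
    where open ≡-Reasoning

  ones : ∀ {n} → Vec Bool n → ℕ
  ones A = Vec.sum (Vec.map bit A)

  sign : Bool → ℤ
  sign false = -1ℤ
  sign true  = 1ℤ

  excess : ∀ {n} → Vec Bool n → ℤ
  excess []      = 0ℤ
  excess (b ∷ A) = sign b + excess A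

  2ones≡n+excess : ∀ {n} (A : Vec Bool n) → + (2 ℕ.* ones A) ≡ + n + excess A
  2ones≡n+excess []      = refl
  2ones≡n+excess {suc n} (false ∷ A) = trans (2ones≡n+excess A) (e (+ n) (excess A))
    where
    e : ∀ n x → n + x ≡ 1ℤ + n + (-1ℤ + x)
    e = ℤ-Ring.solve-∀
  2ones≡n+excess {suc n} (true ∷ A) = begin
    + (2 ℕ.* suc (ones A))     ≡⟨ cong +_ (ℕ.*-suc 2 (ones A)) ⟩
    + 2 + + (2 ℕ.* ones A)     ≡⟨ cong (λ y → + 2 + y) (2ones≡n+excess A) ⟩
    + 2 + (+ n + excess A)     ≡⟨ e (+ n) (excess A) ⟩
    + suc n + (1ℤ + excess A)  ∎
    where
    open ≡-Reasoning
    e : ∀ n x → + 2 + (n + x) ≡ 1ℤ + n + (1ℤ + x)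
    e = ℤ-Ring.solve-∀

  excess-complement : ∀ {n} (A : Vec Bool n) → excess (Vec.map not A) ≡ - excess A
  excess-complement []          = refl
  excess-complement (false ∷ A) = trans (cong (λ y → 1ℤ + y) (excess-complement A)) (sym (ℤ.neg-distrib-+ -1ℤ (excess A)))
  excess-complement (true ∷ A)  = trans (cong (λ y → -1ℤ + y) (excess-complement A)) (sym (ℤ.neg-distrib-+ 1ℤ (excess A)))

  excess-split : ∀ q {n} (A : Vec Bool (q ℕ.+ n)) → excess A ≡ excess (take q A) + excess (drop q A)
  excess-split zero    A       = sym (ℤ.+-identityˡ _)
  excess-split (suc q) (b ∷ A) = trans (cong (λ y → sign b + y) (excess-split q A)) (sym (ℤ.+-assoc (sign b) _ _))

  ∣excess∣≤n : ∀ {n} (A : Vec Bool n) → ∣ excess A ∣ ℕ.≤ n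
  ∣excess∣≤n []      = ℕ.z≤n
  ∣excess∣≤n (b ∷ A) = ℕ.≤-trans (ℤ.∣i+j∣≤∣i∣+∣j∣ (sign b) (excess A)) (ℕ.+-mono-≤ (∣sign∣≤1 b) (∣excess∣≤n A))
    where
    ∣sign∣≤1 : ∀ b → ∣ sign b ∣ ℕ.≤ 1
    ∣sign∣≤1 false = ℕ.≤-refl
    ∣sign∣≤1 true  = ℕ.≤-refl

  -- Complementing all bits permutes the cube and negates the excess, so the sum equals its own
  -- negative.
  ∑-odd≡0 : ∀ {n} (h : ℤ → ℤ) → (∀ x → h (- x) ≡ - h x) → ∑ {n} (h ∘ excess) ≡ 0ℤ
  ∑-odd≡0 {n} h odd = self-negative _ (begin
    ∑ {n} (h ∘ excess)                   ≡⟨ ∑-complement n (h ∘ excess) ⟨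
    ∑ {n} (h ∘ excess ∘ Vec.map not)     ≡⟨ ∑-cong n (λ A → trans (cong h (excess-complement A)) (odd (excess A))) ⟩
    ∑ {n} (λ A → - h (excess A))         ≡⟨ ∑-neg n (h ∘ excess) ⟩
    - ∑ {n} (h ∘ excess)                 ∎)
    where
    open ≡-Reasoning
    self-negative : ∀ i → i ≡ - i → i ≡ 0ℤ
    self-negative (+ zero)    _ = refl
    self-negative ℤ.+[1+ n ] ()
    self-negative ℤ.-[1+ n ] ()

  -- One more coordinate adds 1 to the second moment, because (x - 1)² + (x + 1)² = 2x² + 2.
  ∑-excess² : ∀ n → ∑ {n} (λ A → excess A * excess A) ≡ + n * + (2 ℕ.^ n)
  ∑-excess² zero    = refl
  ∑-excess² (suc n) = begin
    ∑ (λ A → (-1ℤ + X A) * (-1ℤ + X A)) + ∑ (λ A → (1ℤ + X A) * (1ℤ + X A))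
      ≡⟨ ∑-+ n _ _ ⟨
    ∑ (λ A → (-1ℤ + X A) * (-1ℤ + X A) + (1ℤ + X A) * (1ℤ + X A))
      ≡⟨ ∑-cong n (e₁ ∘ X) ⟩
    ∑ (λ A → + 2 * (X A * X A) + + 2)
      ≡⟨ ∑-+ n _ _ ⟩
    ∑ (λ A → + 2 * (X A * X A)) + ∑ {n} (λ _ → + 2)
      ≡⟨ cong₂ _+_ (trans (∑-* n (+ 2) _) (cong (λ y → + 2 * y) (∑-excess² n))) (∑-const n (+ 2)) ⟩
    + 2 * (+ n * + (2 ℕ.^ n)) + + (2 ℕ.^ n) * + 2
      ≡⟨ e₂ (+ n) (+ (2 ℕ.^ n)) ⟩
    + suc n * (+ 2 * + (2 ℕ.^ n))
      ≡⟨ cong (λ y → + suc n * y) (ℤ.pos-* 2 (2 ℕ.^ n)) ⟨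
    + suc n * + (2 ℕ.^ suc n) ∎
    where
    open ≡-Reasoning
    X = excess {n}
    e₁ : ∀ x → (-1ℤ + x) * (-1ℤ + x) + (1ℤ + x) * (1ℤ + x) ≡ + 2 * (x * x) + + 2
    e₁ = ℤ-Ring.solve-∀
    e₂ : ∀ n q → + 2 * (n * q) + q * + 2 ≡ (1ℤ + n) * (+ 2 * q)
    e₂ = ℤ-Ring.solve-∀

  -- The fourth moment is 3n² - 2n, with the negative term moved to the left. The induction uses (x
  -- - 1)⁴ + (x + 1)⁴ = 2x⁴ + 12x² + 2 and the second moment.
  ∑-excess⁴ : ∀ n → ∑ {n} (λ A → excess A * excess A * (excess A * excess A)) + + 2 * (+ n * + (2 ℕ.^ n)) ≡ + 3 * (+ n * + n) * + (2 ℕ.^ n)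
  ∑-excess⁴ zero    = refl
  ∑-excess⁴ (suc n) = begin
    ∑ (λ A → (-1ℤ + X A) * (-1ℤ + X A) * ((-1ℤ + X A) * (-1ℤ + X A))) + ∑ (λ A → (1ℤ + X A) * (1ℤ + X A) * ((1ℤ + X A) * (1ℤ + X A))) + c (suc n)
      ≡⟨ cong (_+ c (suc n)) (∑-+ n _ _) ⟨
    ∑ (λ A → (-1ℤ + X A) * (-1ℤ + X A) * ((-1ℤ + X A) * (-1ℤ + X A)) + (1ℤ + X A) * (1ℤ + X A) * ((1ℤ + X A) * (1ℤ + X A))) + c (suc n)
      ≡⟨ cong (_+ c (suc n)) (∑-cong n (e₁ ∘ X)) ⟩
    ∑ (λ A → + 2 * (X A * X A * (X A * X A)) + (+ 12 * (X A * X A) + + 2)) + c (suc n)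
      ≡⟨ cong (_+ c (suc n)) (trans (∑-+ n _ _) (cong₂ _+_ (∑-* n (+ 2) _) (∑-+ n _ _))) ⟩
    + 2 * S₄ + (∑ (λ A → + 12 * (X A * X A)) + ∑ {n} (λ _ → + 2)) + c (suc n)
      ≡⟨ cong (λ y → + 2 * S₄ + y + c (suc n)) (cong₂ _+_ (trans (∑-* n (+ 12) _) (cong (λ y → + 12 * y) (∑-excess² n))) (∑-const n (+ 2))) ⟩
    + 2 * S₄ + (+ 12 * (+ n * Q) + Q * + 2) + c (suc n)
      ≡⟨ cong (λ y → + 2 * S₄ + (+ 12 * (+ n * Q) + Q * + 2) + + 2 * (+ suc n * y)) (ℤ.pos-* 2 (2 ℕ.^ n)) ⟩
    + 2 * S₄ + (+ 12 * (+ n * Q) + Q * + 2) + + 2 * (+ suc n * (+ 2 * Q))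
      ≡⟨ e₂ S₄ (+ n) Q ⟩
    + 2 * (S₄ + + 2 * (+ n * Q)) + (+ 12 * (+ n * Q) + Q * + 6)
      ≡⟨ cong (λ y → + 2 * y + (+ 12 * (+ n * Q) + Q * + 6)) (∑-excess⁴ n) ⟩
    + 2 * (+ 3 * (+ n * + n) * Q) + (+ 12 * (+ n * Q) + Q * + 6)
      ≡⟨ e₃ (+ n) Q ⟩
    + 3 * (+ suc n * + suc n) * (+ 2 * Q)
      ≡⟨ cong (λ y → + 3 * (+ suc n * + suc n) * y) (ℤ.pos-* 2 (2 ℕ.^ n)) ⟨
    + 3 * (+ suc n * + suc n) * + (2 ℕ.^ suc n) ∎
    where
    open ≡-Reasoning
    X = excess {n}
    Q = + (2 ℕ.^ n)
    S₄ = ∑ (λ A → X A * X A * (X A * X A))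
    c = λ k → + 2 * (+ k * + (2 ℕ.^ k))
    e₁ : ∀ x → (-1ℤ + x) * (-1ℤ + x) * ((-1ℤ + x) * (-1ℤ + x)) + (1ℤ + x) * (1ℤ + x) * ((1ℤ + x) * (1ℤ + x))
             ≡ + 2 * (x * x * (x * x)) + (+ 12 * (x * x) + + 2)
    e₁ = ℤ-Ring.solve-∀
    e₂ : ∀ s n q → + 2 * s + (+ 12 * (n * q) + q * + 2) + + 2 * ((1ℤ + n) * (+ 2 * q)) ≡ + 2 * (s + + 2 * (n * q)) + (+ 12 * (n * q) + q * + 6)
    e₂ = ℤ-Ring.solve-∀
    e₃ : ∀ n q → + 2 * (+ 3 * (n * n) * q) + (+ 12 * (n * q) + q * + 6) ≡ + 3 * ((1ℤ + n) * (1ℤ + n)) * (+ 2 * q)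
    e₃ = ℤ-Ring.solve-∀

  ∑-excess⁴-≤ : ∀ n → ∑ {n} (λ A → excess A * excess A * (excess A * excess A)) ≤ + 3 * (+ n * + n) * + (2 ℕ.^ n)
  ∑-excess⁴-≤ n = subst (∑ {n} X⁴ ≤_) (∑-excess⁴ n)
    (ℤ.i≤i+j (∑ {n} X⁴) (+ 2 * (+ n * + (2 ℕ.^ n))) {{subst ℤ.NonNegative (sym eq) _}})
    where
    X⁴ = λ (A : Vec Bool n) → excess A * excess A * (excess A * excess A)
    eq : + 2 * (+ n * + (2 ℕ.^ n)) ≡ + (2 ℕ.* (n ℕ.* 2 ℕ.^ n))
    eq = trans (cong (λ y → + 2 * y) (sym (ℤ.pos-* n (2 ℕ.^ n)))) (sym (ℤ.pos-* 2 (n ℕ.* 2 ℕ.^ n)))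

-- Rounding by thresholds

module _ where
  open import Data.Integer using (+_; -_; _+_; _-_; _*_; _≤_; _<_; +≤+; 0ℤ; 1ℤ; ∣_∣; _≤?_)

  -- The mirror image of the threshold jd is 1 - jd: over the integers, x fails 1 - jd exactly when
  -- -x reaches jd. This is what makes `step` odd.
  thresholds : ℕ → ∀ T → Vec ℤ (T ℕ.* 2)
  thresholds d zero    = []
  thresholds d (suc T) = + (suc T ℕ.* d) ∷ 1ℤ - + (suc T ℕ.* d) ∷ thresholds d T

  crossings : ∀ {l} → Vec ℤ l → ℤ → ℕ
  crossings θs x = Vec.sum (Vec.map (λ θ → bit ⌊ θ ≤? x ⌋) θs)

  -- The number of j ≤ T with jd ≤ x minus the number with jd ≤ -x. For d ≥ 1, d times this value is
  -- x rounded towards zero to a multiple of d and clipped to [-Td, Td].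
  step : ℕ → ℕ → ℤ → ℤ
  step d T x = + crossings (thresholds d T) x - + T

  bit-yes : ∀ {p} {P : Set p} (P? : Dec P) → P → ⟦ ⌊ P? ⌋ ⟧ ≡ 1ℤ
  bit-yes (yes _) _ = refl
  bit-yes (no ¬p) p = contradiction p ¬p

  bit-no : ∀ {p} {P : Set p} (P? : Dec P) → ¬ P → ⟦ ⌊ P? ⌋ ⟧ ≡ 0ℤ
  bit-no (yes p) ¬p = contradiction p ¬p
  bit-no (no _)  _  = refl

  threshold-reflect : ∀ θ x → ⟦ ⌊ θ ≤? - x ⌋ ⟧ + ⟦ ⌊ 1ℤ - θ ≤? x ⌋ ⟧ ≡ 1ℤ
  threshold-reflect θ x with θ ≤? - x
  ... | yes θ≤-x = cong (λ y → 1ℤ + y) (bit-no (1ℤ - θ ≤? x) λ 1-θ≤x → contradiction (subst₂ _≤_ (e₁ θ) (ℤ.+-inverseʳ x) (ℤ.+-mono-≤ 1-θ≤x θ≤-x)) λ { (+≤+ ()) })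
    where
    e₁ : ∀ θ → 1ℤ - θ + θ ≡ 1ℤ
    e₁ = ℤ-Ring.solve-∀
  ... | no θ≰-x = trans (ℤ.+-identityˡ _) (bit-yes (1ℤ - θ ≤? x) (subst₂ _≤_ (e₁ θ x) (e₂ θ x) (ℤ.+-monoˡ-≤ (x - θ) (ℤ.i<j⇒suc[i]≤j (ℤ.≰⇒> θ≰-x)))))
    where
    e₁ : ∀ θ x → 1ℤ + - x + (x - θ) ≡ 1ℤ - θ
    e₁ = ℤ-Ring.solve-∀
    e₂ : ∀ θ x → θ + (x - θ) ≡ x
    e₂ = ℤ-Ring.solve-∀

  step-suc : ∀ d T x → step d (suc T) x ≡
             ⟦ ⌊ + (suc T ℕ.* d) ≤? x ⌋ ⟧ + ⟦ ⌊ 1ℤ - + (suc T ℕ.* d) ≤? x ⌋ ⟧ - 1ℤ + step d T x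
  step-suc d T x = e ⟦ ⌊ + (suc T ℕ.* d) ≤? x ⌋ ⟧ ⟦ ⌊ 1ℤ - + (suc T ℕ.* d) ≤? x ⌋ ⟧ (+ crossings (thresholds d T) x) (+ T)
    where
    e : ∀ a b c t → a + (b + c) - (1ℤ + t) ≡ a + b - 1ℤ + (c - t)
    e = ℤ-Ring.solve-∀

  step-odd : ∀ d T x → step d T (- x) ≡ - step d T x
  step-odd d zero    x = refl
  step-odd d (suc T) x = begin
    step d (suc T) (- x)                       ≡⟨ step-suc d T (- x) ⟩
    p (- x) + m (- x) - 1ℤ + step d T (- x)    ≡⟨ cong (λ y → p (- x) + m (- x) - 1ℤ + y) (step-odd d T x) ⟩
    p (- x) + m (- x) - 1ℤ + - step d T x      ≡⟨ e₁ (p (- x)) (m (- x)) (p x) (m x) (step d T x) ⟩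
    (p (- x) + m x) + (m (- x) + p x) - + 2 + - (p x + m x - 1ℤ + step d T x)
      ≡⟨ cong₂ (λ y z → y + z - + 2 + - (p x + m x - 1ℤ + step d T x)) (threshold-reflect θ x) reflect′ ⟩
    0ℤ + - (p x + m x - 1ℤ + step d T x)       ≡⟨ trans (ℤ.+-identityˡ _) (cong -_ (sym (step-suc d T x))) ⟩
    - step d (suc T) x                         ∎
    where
    open ≡-Reasoning
    θ = + (suc T ℕ.* d)
    p m : ℤ → ℤ
    p y = ⟦ ⌊ θ ≤? y ⌋ ⟧
    m y = ⟦ ⌊ 1ℤ - θ ≤? y ⌋ ⟧
    e₁ : ∀ a b c d s → a + b - 1ℤ + - s ≡ (a + d) + (b + c) - + 2 + - (c + d - 1ℤ + s)
    e₁ = ℤ-Ring.solve-∀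
    e₂ : ∀ θ → 1ℤ - (1ℤ - θ) ≡ θ
    e₂ = ℤ-Ring.solve-∀
    -- Reflection is applied to 1 - θ, whose mirror threshold 1 - (1 - θ) is θ again.
    reflect′ : m (- x) + p x ≡ 1ℤ
    reflect′ = subst (λ y → m (- x) + ⟦ ⌊ y ≤? x ⌋ ⟧ ≡ 1ℤ) (e₂ θ) (threshold-reflect (1ℤ - θ) x)

  nonneg-lower-crossing : ∀ d T a → 1 ℕ.≤ d → ⟦ ⌊ 1ℤ - + (suc T ℕ.* d) ≤? + a ⌋ ⟧ ≡ 1ℤ
  nonneg-lower-crossing (suc d) T a _ =
    bit-yes (_ ≤? _) (ℤ.≤-trans (ℤ.+-monoʳ-≤ 1ℤ (ℤ.neg-mono-≤ (+≤+ (ℕ.s≤s (ℕ.z≤n {d ℕ.+ T ℕ.* suc d}))))) (+≤+ ℕ.z≤n))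

  -- Here `c` is the smaller of `T` and the integer quotient of `a` by `d`. The disjunction
  -- separates saturation from a true quotient; in the latter case c ≤ T rules out that the next
  -- threshold (T + 1)d is crossed.
  step-nonneg : ∀ d T a → 1 ℕ.≤ d →
                ∃[ c ] step d T (+ a) ≡ + c × c ℕ.* d ℕ.≤ a × (c ≡ T ⊎ c ℕ.≤ T × a ℕ.< suc c ℕ.* d)
  step-nonneg d zero    a d≥1 = 0 , refl , ℕ.z≤n , inj₁ refl
  step-nonneg d (suc T) a d≥1 = extend (step-nonneg d T a d≥1) (suc T ℕ.* d ℕ.≤? a)
    where
    step-suc-at : ∀ {c y} → step d T (+ a) ≡ + c → ⟦ ⌊ + (suc T ℕ.* d) ≤? + a ⌋ ⟧ ≡ y → step d (suc T) (+ a) ≡ y + 1ℤ - 1ℤ + + c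
    step-suc-at eq eq′ = trans (step-suc d T (+ a)) (cong₂ _+_ (cong₂ (λ y z → y + z - 1ℤ) eq′ (nonneg-lower-crossing d T a d≥1)) eq)
    extend : ∃[ c ] step d T (+ a) ≡ + c × c ℕ.* d ℕ.≤ a × (c ≡ T ⊎ c ℕ.≤ T × a ℕ.< suc c ℕ.* d) →
             Dec (suc T ℕ.* d ℕ.≤ a) →
             ∃[ c ] step d (suc T) (+ a) ≡ + c × c ℕ.* d ℕ.≤ a × (c ≡ suc T ⊎ c ℕ.≤ suc T × a ℕ.< suc c ℕ.* d)
    extend (c , eq , cd≤a , inj₁ refl) (yes le) =
      suc T , step-suc-at eq (bit-yes (_ ≤? _) (+≤+ le)) , le , inj₁ refl
    extend (c , eq , cd≤a , inj₂ (c≤T , a<)) (yes le) =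
      contradiction (ℕ.≤-trans (ℕ.*-monoˡ-≤ d (ℕ.s≤s c≤T)) le) (ℕ.<⇒≱ a<)
    extend (c , eq , cd≤a , inj₁ refl) (no nle) =
      c , step-suc-at eq (bit-no (_ ≤? _) (nle ∘ ℤ.drop‿+≤+)) , cd≤a , inj₂ (ℕ.n≤1+n c , ℕ.≰⇒> nle)
    extend (c , eq , cd≤a , inj₂ (c≤T , a<)) (no nle) =
      c , step-suc-at eq (bit-no (_ ≤? _) (nle ∘ ℤ.drop‿+≤+)) , cd≤a , inj₂ (ℕ.m≤n⇒m≤1+n c≤T , a<)

  error : ℕ → ℕ → ℤ → ℤ
  error d T x = x - + d * step d T x

  error-odd : ∀ d T x → error d T (- x) ≡ - error d T x
  error-odd d T x = trans (cong (λ y → - x - + d * y) (step-odd d T x)) (e x (+ d) (step d T x))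
    where
    e : ∀ x d s → - x - d * - s ≡ - (x - d * s)
    e = ℤ-Ring.solve-∀

  -- Rounding towards zero never overshoots, and below (T + 1)d clipping has no effect, so only a
  -- remainder modulo d is left. Negative arguments follow by oddness.
  ∣error∣-bounds : ∀ d T x → 1 ℕ.≤ d →
                   ∣ error d T x ∣ ℕ.≤ ∣ x ∣ × (∣ x ∣ ℕ.< suc T ℕ.* d → ∣ error d T x ∣ ℕ.< d)
  ∣error∣-bounds d T (+ a) d≥1 with step-nonneg d T a d≥1
  ... | c , eq , cd≤a , cases = subst (ℕ._≤ a) (sym abs) (ℕ.m∸n≤m a (c ℕ.* d)) , λ a< → subst (ℕ._< d) (sym abs) (remainder a< cases)
    where
    abs : ∣ error d T (+ a) ∣ ≡ a ℕ.∸ c ℕ.* d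
    abs = cong ∣_∣ (begin
      + a - + d * step d T (+ a)      ≡⟨ cong (λ y → + a - + d * y) eq ⟩
      + a - + d * + c                 ≡⟨ cong (λ y → + a - y) (trans (ℤ.*-comm (+ d) (+ c)) (sym (ℤ.pos-* c d))) ⟩
      + a - + (c ℕ.* d)               ≡⟨ ℤ.m-n≡m⊖n a (c ℕ.* d) ⟩
      a ℤ.⊖ c ℕ.* d                   ≡⟨ ℤ.⊖-≥ cd≤a ⟩
      + (a ℕ.∸ c ℕ.* d)               ∎)
      where open ≡-Reasoning
    below : ∀ c → c ℕ.* d ℕ.≤ a → a ℕ.< suc c ℕ.* d → a ℕ.∸ c ℕ.* d ℕ.< d
    below c cd≤a a< = ℕ.+-cancelʳ-< (c ℕ.* d) _ _ (subst (ℕ._< d ℕ.+ c ℕ.* d) (sym (ℕ.m∸n+n≡m cd≤a)) a<)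
    remainder : a ℕ.< suc T ℕ.* d → (c ≡ T ⊎ c ℕ.≤ T × a ℕ.< suc c ℕ.* d) → a ℕ.∸ c ℕ.* d ℕ.< d
    -- Under saturation the hypothesis on `a` itself supplies the upper bound a < (c + 1)d.
    remainder a< (inj₁ refl)     = below c cd≤a a<
    remainder _  (inj₂ (_ , a<)) = below c cd≤a a<
  ∣error∣-bounds d T ℤ.-[1+ a ] d≥1 with le , lt ← ∣error∣-bounds d T (+ suc a) d≥1 =
    subst (ℕ._≤ suc a) (sym abs) le , λ a< → subst (ℕ._< d) (sym abs) (lt a<)
    where
    abs : ∣ error d T ℤ.-[1+ a ] ∣ ≡ ∣ error d T (+ suc a) ∣
    abs = trans (cong ∣_∣ (error-odd d T (+ suc a))) (ℤ.∣-i∣≡∣i∣ (error d T (+ suc a)))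

  square : ∀ i → i * i ≡ + (∣ i ∣ ℕ.* ∣ i ∣)
  square (+ a)      = sym (ℤ.pos-* a a)
  square ℤ.-[1+ a ] = refl

  -- Inside the window of the thresholds the error is below d; outside, ∣ x ∣ ≥ T d and so x² · (T d)² ≤ x⁴.
  error²-≤ : ∀ d T x → 1 ℕ.≤ d →
             + (T ℕ.* d ℕ.* (T ℕ.* d)) * (error d T x * error d T x) ≤
             + (T ℕ.* d ℕ.* (T ℕ.* d) ℕ.* (d ℕ.* d)) + x * x * (x * x)
  error²-≤ d T x d≥1 = subst₂ _≤_ lhs rhs (+≤+ bound)
    where
    K = T ℕ.* d ℕ.* (T ℕ.* d)
    h = ∣ error d T x ∣
    a = ∣ x ∣
    lhs : + (K ℕ.* (h ℕ.* h)) ≡ + K * (error d T x * error d T x)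
    lhs = trans (ℤ.pos-* K (h ℕ.* h)) (cong (λ y → + K * y) (sym (square (error d T x))))
    rhs : + (K ℕ.* (d ℕ.* d) ℕ.+ a ℕ.* a ℕ.* (a ℕ.* a)) ≡ + (K ℕ.* (d ℕ.* d)) + x * x * (x * x)
    rhs = cong (λ y → + (K ℕ.* (d ℕ.* d)) + y)
      (trans (ℤ.pos-* (a ℕ.* a) (a ℕ.* a)) (cong₂ _*_ (sym (square x)) (sym (square x))))
    bound : K ℕ.* (h ℕ.* h) ℕ.≤ K ℕ.* (d ℕ.* d) ℕ.+ a ℕ.* a ℕ.* (a ℕ.* a)
    bound with suc T ℕ.* d ℕ.≤? a | ∣error∣-bounds d T x d≥1
    ... | yes le | h≤a , _ = ℕ.≤-trans (ℕ.*-mono-≤ (ℕ.*-mono-≤ Td≤a Td≤a) (ℕ.*-mono-≤ h≤a h≤a)) (ℕ.m≤n+m _ (K ℕ.* (d ℕ.* d)))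
      where
      Td≤a = ℕ.≤-trans (ℕ.m≤n+m (T ℕ.* d) d) le
    ... | no nle | _ , small = ℕ.≤-trans (ℕ.*-monoʳ-≤ K (ℕ.*-mono-≤ h≤d h≤d)) (ℕ.m≤m+n _ _)
      where
      h≤d = ℕ.<⇒≤ (small (ℕ.≰⇒> nle))

  -- Averaging `error²-≤` gives a second moment of at most d² + 3q²/(Td)², and q ≤ Td² turns the
  -- last term into 3d². The factor K = (Td)² is kept on both sides and cancelled at the end.
  ∑-error² : ∀ d T q → 1 ℕ.≤ d → 1 ℕ.≤ T → q ℕ.≤ T ℕ.* (d ℕ.* d) →
             ∑ {q} (λ A → error d T (excess A) * error d T (excess A)) ≤ + (4 ℕ.* (d ℕ.* d)) * + (2 ℕ.^ q)
  ∑-error² d@(suc _) T@(suc _) q d≥1 T≥1 q≤ = ℤ.*-cancelˡ-≤-pos _ _ (+ K) (begin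
    + K * ∑ {q} h²                                          ≡⟨ ∑-* q (+ K) h² ⟨
    ∑ {q} (λ A → + K * h² A)                                ≤⟨ ∑-mono q (λ A → error²-≤ d T (excess A) d≥1) ⟩
    ∑ {q} (λ A → + (K ℕ.* (d ℕ.* d)) + x⁴ A)                ≡⟨ ∑-+ q _ x⁴ ⟩
    ∑ {q} (λ A → + (K ℕ.* (d ℕ.* d))) + ∑ {q} x⁴            ≤⟨ ℤ.+-mono-≤ (ℤ.≤-reflexive (∑-const q _)) (∑-excess⁴-≤ q) ⟩
    + Q * + (K ℕ.* (d ℕ.* d)) + + 3 * (+ q * + q) * + Q     ≡⟨ lhs ⟩
    + (Q ℕ.* (K ℕ.* (d ℕ.* d)) ℕ.+ 3 ℕ.* (q ℕ.* q) ℕ.* Q)   ≤⟨ +≤+ (ℕ.≤-trans (ℕ.+-monoʳ-≤ (Q ℕ.* (K ℕ.* (d ℕ.* d))) (ℕ.*-monoˡ-≤ Q (ℕ.*-monoʳ-≤ 3 (ℕ.*-mono-≤ q≤ q≤)))) (ℕ.≤-reflexive (e T d Q))) ⟩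
    + (K ℕ.* (4 ℕ.* (d ℕ.* d) ℕ.* Q))                       ≡⟨ trans (ℤ.pos-* K _) (cong (λ y → + K * y) (ℤ.pos-* (4 ℕ.* (d ℕ.* d)) Q)) ⟩
    + K * (+ (4 ℕ.* (d ℕ.* d)) * + Q)                       ∎)
    where
    open ℤ.≤-Reasoning
    K = T ℕ.* d ℕ.* (T ℕ.* d)
    Q = 2 ℕ.^ q
    h² x⁴ : Vec Bool q → ℤ
    h² A = error d T (excess A) * error d T (excess A)
    x⁴ A = excess A * excess A * (excess A * excess A)
    lhs : + Q * + (K ℕ.* (d ℕ.* d)) + + 3 * (+ q * + q) * + Q ≡ + (Q ℕ.* (K ℕ.* (d ℕ.* d)) ℕ.+ 3 ℕ.* (q ℕ.* q) ℕ.* Q)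
    lhs = cong₂ _+_ (sym (ℤ.pos-* Q (K ℕ.* (d ℕ.* d))))
      (sym (trans (ℤ.pos-* (3 ℕ.* (q ℕ.* q)) Q) (cong (λ y → y * + Q) (trans (ℤ.pos-* 3 (q ℕ.* q)) (cong (λ y → + 3 * y) (ℤ.pos-* q q))))))
    e : ∀ T d Q → Q ℕ.* (T ℕ.* d ℕ.* (T ℕ.* d) ℕ.* (d ℕ.* d)) ℕ.+ 3 ℕ.* (T ℕ.* (d ℕ.* d) ℕ.* (T ℕ.* (d ℕ.* d))) ℕ.* Q
                ≡ T ℕ.* d ℕ.* (T ℕ.* d) ℕ.* (4 ℕ.* (d ℕ.* d) ℕ.* Q)
    e = ℕ-Ring.solve-∀

-- Block decompositions and circuits

module _ where
  open import Data.Integer using (+_; -_; _+_; _-_; _*_; _≤_; _<_; +≤+; 0ℤ; 1ℤ; ∣_∣; _≤?_)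

  data Blocks (p : ℕ) : ℕ → ℕ → Set where
    []    : Blocks p 0 0
    block : ∀ q {m n} → q ℕ.≤ p → Blocks p m n → Blocks p (suc m) (q ℕ.+ n)

  -- Greedy cutting: each block takes as many of the remaining variables as fit. Trailing blocks may
  -- be empty, so the number of blocks is exactly `m`.
  blocks : ∀ p m n → n ℕ.≤ m ℕ.* p → Blocks p m n
  blocks p zero    zero n≤ = []
  blocks p (suc m) n    n≤ = subst (Blocks p (suc m)) (ℕ.m⊓n+n∸m≡n p n)
    (block (p ℕ.⊓ n) (ℕ.m⊓n≤m p n) (blocks p m (n ℕ.∸ p) (ℕ.m≤n+o⇒m∸n≤o n p n≤)))

  module _ (d T : ℕ) {p : ℕ} where

    blockError : ∀ {m n} → Blocks p m n → Vec Bool n → ℤ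
    blockError []             A = 0ℤ
    blockError (block q _ bs) A = error d T (excess (take q A)) + blockError bs (drop q A)

    blockCrossings : ∀ {m n} → Blocks p m n → Vec Bool n → ℕ
    blockCrossings []             A = 0
    blockCrossings (block q _ bs) A = crossings (thresholds d T) (excess (take q A)) ℕ.+ blockCrossings bs (drop q A)

    -- The identity x = error + d · step, summed over the blocks. The factor multiplied by d is the
    -- number of firing bottom gates minus mT, which is what the top gate tests.
    excess≡error+steps : ∀ {m n} (bs : Blocks p m n) A →
                         excess A ≡ blockError bs A + + d * (+ blockCrossings bs A - + (m ℕ.* T))
    excess≡error+steps [] [] = sym (trans (ℤ.+-identityˡ _) (ℤ.*-zeroʳ (+ d)))
    excess≡error+steps {suc m} (block q _ bs) A = trans (excess-split q A)
      (trans (cong (λ y → excess (take q A) + y) (excess≡error+steps bs (drop q A)))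
        (e (excess (take q A)) (blockError bs (drop q A)) (+ d) (+ crossings (thresholds d T) (excess (take q A)))
           (+ blockCrossings bs (drop q A)) (+ T) (+ (m ℕ.* T))))
      where
      e : ∀ x h d a b t mt → x + (h + d * (b - mt)) ≡ x - d * (a - t) + h + d * (a + b - (t + mt))
      e = ℤ-Ring.solve-∀

    -- The error of each block is an odd function of that block's excess, hence centred by
    -- `∑-odd≡0`.
    ∑-blockError : ∀ {m n} (bs : Blocks p m n) → ∑ (blockError bs) ≡ 0ℤ
    ∑-blockError [] = refl
    ∑-blockError (block q {n = n} _ bs) = begin
      ∑ (λ A → h (take q A) + H (drop q A))            ≡⟨ ∑-split q (λ u v → h u + H v) ⟩
      ∑ {q} (λ u → ∑ {n} (λ v → h u + H v))            ≡⟨ ∑-cong q (λ u → trans (∑-+ n (λ _ → h u) H) (cong₂ _+_ (∑-const n (h u)) (∑-blockError bs))) ⟩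
      ∑ {q} (λ u → + (2 ℕ.^ n) * h u + 0ℤ)             ≡⟨ ∑-cong q (λ u → ℤ.+-identityʳ (+ (2 ℕ.^ n) * h u)) ⟩
      ∑ {q} (λ u → + (2 ℕ.^ n) * h u)                  ≡⟨ ∑-* q (+ (2 ℕ.^ n)) h ⟩
      + (2 ℕ.^ n) * ∑ {q} h                            ≡⟨ cong (λ y → + (2 ℕ.^ n) * y) (∑-odd≡0 {q} (error d T) (error-odd d T)) ⟩
      + (2 ℕ.^ n) * 0ℤ                                 ≡⟨ ℤ.*-zeroʳ (+ (2 ℕ.^ n)) ⟩
      0ℤ                                               ∎
      where
      open ≡-Reasoning
      h : Vec Bool q → ℤ
      h u = error d T (excess u)
      H = blockError bs

    -- The errors of distinct blocks are independent and centred, so that the cross terms cancel.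
    ∑-blockError²-split : ∀ q {m n} (q≤p : q ℕ.≤ p) (bs : Blocks p m n) →
      ∑ (λ A → blockError (block q q≤p bs) A * blockError (block q q≤p bs) A) ≡
      + (2 ℕ.^ n) * ∑ {q} (λ u → error d T (excess u) * error d T (excess u)) +
      + (2 ℕ.^ q) * ∑ (λ v → blockError bs v * blockError bs v)
    ∑-blockError²-split q {n = n} q≤p bs = begin
      ∑ (λ A → (h (take q A) + H (drop q A)) * (h (take q A) + H (drop q A)))
        ≡⟨ ∑-split q (λ u v → (h u + H v) * (h u + H v)) ⟩
      ∑ {q} (λ u → ∑ {n} (λ v → (h u + H v) * (h u + H v)))
        ≡⟨ ∑-cong q inner ⟩
      ∑ {q} (λ u → + (2 ℕ.^ n) * (h u * h u) + ∑ H²)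
        ≡⟨ ∑-+ q _ (λ _ → ∑ H²) ⟩
      ∑ {q} (λ u → + (2 ℕ.^ n) * (h u * h u)) + ∑ {q} (λ _ → ∑ H²)
        ≡⟨ cong₂ _+_ (∑-* q (+ (2 ℕ.^ n)) (λ u → h u * h u)) (∑-const q (∑ H²)) ⟩
      + (2 ℕ.^ n) * ∑ {q} (λ u → h u * h u) + + (2 ℕ.^ q) * ∑ H² ∎
      where
      open ≡-Reasoning
      h : Vec Bool q → ℤ
      h u = error d T (excess u)
      H H² : Vec Bool n → ℤ
      H = blockError bs
      H² v = H v * H v
      binomial : ∀ a b → (a + b) * (a + b) ≡ a * a + (+ 2 * a * b + b * b)
      binomial = ℤ-Ring.solve-∀
      inner : ∀ u → ∑ {n} (λ v → (h u + H v) * (h u + H v)) ≡ + (2 ℕ.^ n) * (h u * h u) + ∑ H²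
      inner u = begin
        ∑ {n} (λ v → (h u + H v) * (h u + H v))                               ≡⟨ ∑-cong n (λ v → binomial (h u) (H v)) ⟩
        ∑ {n} (λ v → h u * h u + (+ 2 * h u * H v + H² v))                    ≡⟨ ∑-+ n (λ _ → h u * h u) (λ v → + 2 * h u * H v + H² v) ⟩
        ∑ {n} (λ _ → h u * h u) + ∑ (λ v → + 2 * h u * H v + H² v)            ≡⟨ cong₂ _+_ (∑-const n (h u * h u)) (∑-+ n (λ v → + 2 * h u * H v) H²) ⟩
        + (2 ℕ.^ n) * (h u * h u) + (∑ (λ v → + 2 * h u * H v) + ∑ H²)        ≡⟨ cong (λ y → + (2 ℕ.^ n) * (h u * h u) + (y + ∑ H²)) centred ⟩
        + (2 ℕ.^ n) * (h u * h u) + (0ℤ + ∑ H²)                               ≡⟨ cong (λ y → + (2 ℕ.^ n) * (h u * h u) + y) (ℤ.+-identityˡ (∑ H²)) ⟩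
        + (2 ℕ.^ n) * (h u * h u) + ∑ H²                                      ∎
        where
        centred : ∑ (λ v → + 2 * h u * H v) ≡ 0ℤ
        centred = trans (∑-* n (+ 2 * h u) H) (trans (cong (λ y → + 2 * h u * y) (∑-blockError bs)) (ℤ.*-zeroʳ (+ 2 * h u)))

    -- Variances of independent centred errors add up. With p = Td² every block satisfies the size
    -- condition of `∑-error²`, so each contributes at most 4d².
    ∑-blockError² : 1 ℕ.≤ d → 1 ℕ.≤ T → p ≡ T ℕ.* (d ℕ.* d) → ∀ {m n} (bs : Blocks p m n) →
                    ∑ (λ A → blockError bs A * blockError bs A) ≤ + m * (+ (4 ℕ.* (d ℕ.* d)) * + (2 ℕ.^ n))
    ∑-blockError² d≥1 T≥1 refl [] = ℤ.≤-refl
    ∑-blockError² d≥1 T≥1 refl (block q {m} {n} q≤p bs) = begin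
      ∑ (λ A → blockError (block q q≤p bs) A * blockError (block q q≤p bs) A)
        ≡⟨ ∑-blockError²-split q q≤p bs ⟩
      + (2 ℕ.^ n) * ∑ {q} (λ u → error d T (excess u) * error d T (excess u)) + + (2 ℕ.^ q) * ∑ (λ v → blockError bs v * blockError bs v)
        ≤⟨ ℤ.+-mono-≤ (ℤ.*-monoˡ-≤-nonNeg (+ (2 ℕ.^ n)) (∑-error² d T q d≥1 T≥1 q≤p))
                      (ℤ.*-monoˡ-≤-nonNeg (+ (2 ℕ.^ q)) (∑-blockError² d≥1 T≥1 refl bs)) ⟩
      + (2 ℕ.^ n) * (V * + (2 ℕ.^ q)) + + (2 ℕ.^ q) * (+ m * (V * + (2 ℕ.^ n)))
        ≡⟨ e (+ (2 ℕ.^ n)) (+ (2 ℕ.^ q)) V (+ m) ⟩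
      + suc m * (V * (+ (2 ℕ.^ q) * + (2 ℕ.^ n)))
        ≡⟨ cong (λ y → + suc m * (V * y)) (trans (sym (ℤ.pos-* (2 ℕ.^ q) (2 ℕ.^ n))) (cong +_ (sym (ℕ.^-distribˡ-+-* 2 q n)))) ⟩
      + suc m * (V * + (2 ℕ.^ (q ℕ.+ n))) ∎
      where
      open ℤ.≤-Reasoning
      V = + (4 ℕ.* (d ℕ.* d))
      e : ∀ N Q V m → N * (V * Q) + Q * (m * (V * N)) ≡ (1ℤ + m) * (V * (Q * N))
      e = ℤ-Ring.solve-∀

  -- With d = 1 and blocks no larger than T, every block excess stays below T + 1, so its rounding
  -- error is below 1 and vanishes.
  blockError-exact : ∀ T {p m n} (bs : Blocks p m n) A → p ℕ.≤ T → blockError 1 T bs A ≡ 0ℤ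
  blockError-exact T []               A p≤T = refl
  blockError-exact T (block q q≤p bs) A p≤T = cong₂ _+_
    (ℤ.∣i∣≡0⇒i≡0 {error 1 T (excess (take q A))} (ℕ.n<1⇒n≡0 (proj₂ (∣error∣-bounds 1 T (excess (take q A)) ℕ.≤-refl) small)))
    (blockError-exact T bs (drop q A) p≤T)
    where
    small : ∣ excess (take q A) ∣ ℕ.< suc T ℕ.* 1
    small = subst (∣ excess (take q A) ∣ ℕ.<_) (sym (ℕ.*-identityʳ (suc T))) (ℕ.s≤s (ℕ.≤-trans (∣excess∣≤n (take q A)) (ℕ.≤-trans q≤p p≤T)))

  ⌊⌋-⇔ : ∀ {p q} {P : Set p} {Q : Set q} → P ⇔ Q → (P? : Dec P) (Q? : Dec Q) → ⌊ P? ⌋ ≡ ⌊ Q? ⌋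
  ⌊⌋-⇔ P⇔Q P? Q? = trans (isYes≗does P?) (trans (does-⇔ P⇔Q P? Q?) (sym (isYes≗does Q?)))

  -- Weights 2 make every threshold on 2 · Σ xᵢ available, as in the definition of MAJ.
  doubledGate : ∀ {k I l} → Vec I l → l ℕ.* 2 ℕ.≤ k → ℤ → Gate k I
  doubledGate {l = l} xs 2l≤k θ = gate xs (Vec.replicate l 2) (twos≥1 l) (subst (ℕ._≤ _) (sym (sum-twos l)) 2l≤k) θ
    where
    twos≥1 : ∀ l → All (1 ℕ.≤_) (Vec.replicate l 2)
    twos≥1 zero    = []
    twos≥1 (suc l) = ℕ.s≤s ℕ.z≤n ∷ twos≥1 l
    sum-twos : ∀ l → Vec.sum (Vec.replicate l 2) ≡ l ℕ.* 2
    sum-twos zero    = refl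
    sum-twos (suc l) = cong (2 ℕ.+_) (sum-twos l)

  evalGate-doubled : ∀ {k I l} (xs : Vec I l) (2l≤k : l ℕ.* 2 ℕ.≤ k) θ val →
                     evalGate (doubledGate xs 2l≤k θ) val ≡ ⌊ θ ≤? + (2 ℕ.* Vec.sum (Vec.map (bit ∘ val) xs)) ⌋
  evalGate-doubled xs 2l≤k θ val = cong (λ y → ⌊ θ ≤? + y ⌋) (weighted xs)
    where
    weighted : ∀ {l} (xs : Vec _ l) → Vec.sum (Vec.zipWith ℕ._*_ (Vec.replicate l 2) (Vec.map (λ i → bit (val i)) xs)) ≡
                                      2 ℕ.* Vec.sum (Vec.map (bit ∘ val) xs)
    weighted []       = refl
    weighted (x ∷ xs) = trans (cong (2 ℕ.* bit (val x) ℕ.+_) (weighted xs)) (sym (ℕ.*-distribˡ-+ 2 (bit (val x)) _))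

  -- Since 2 Σ xᵢ = q + excess on q variables, the threshold q + θ with weights 2 tests θ ≤ excess.
  thresholdGates : ∀ {k I q l} → Vec I q → q ℕ.* 2 ℕ.≤ k → Vec ℤ l → Vec (Gate k I) l
  thresholdGates {q = q} xs 2q≤k = Vec.map (λ θ → doubledGate xs 2q≤k (+ q + θ))

  sum-thresholdGates : ∀ {k I q l} (xs : Vec I q) (2q≤k : q ℕ.* 2 ℕ.≤ k) (θs : Vec ℤ l) (val : I → Bool) A → Vec.map val xs ≡ A →
                       Vec.sum (Vec.map (λ g → bit (evalGate g val)) (thresholdGates xs 2q≤k θs)) ≡ crossings θs (excess A)
  sum-thresholdGates xs 2q≤k [] val A eq = refl
  sum-thresholdGates {q = q} xs 2q≤k (θ ∷ θs) val A refl =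
    cong₂ (λ b s → bit b ℕ.+ s)
      (trans (evalGate-doubled xs 2q≤k (+ q + θ) val)
        (trans (cong (λ y → ⌊ + q + θ ≤? y ⌋) value) (⌊⌋-⇔ (mk⇔ (shift (+ q)) (ℤ.+-monoʳ-≤ (+ q))) (_ ≤? _) (_ ≤? _))))
      (sum-thresholdGates xs 2q≤k θs val A refl)
    where
    value : + (2 ℕ.* Vec.sum (Vec.map (bit ∘ val) xs)) ≡ + q + excess (Vec.map val xs)
    value = trans (cong (λ ys → + (2 ℕ.* Vec.sum ys)) (Vec.map-∘ bit val xs)) (2ones≡n+excess (Vec.map val xs))
    shift : ∀ i {j k} → i + j ≤ i + k → j ≤ k
    shift i {j} {k} le = subst₂ _≤_ (e i j) (e i k) (ℤ.+-monoʳ-≤ (- i) le)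
      where
      e : ∀ i j → - i + (i + j) ≡ j
      e = ℤ-Ring.solve-∀

  module _ (d T : ℕ) {k p : ℕ} (2p≤k : p ℕ.* 2 ℕ.≤ k) where

    -- The map `ι` places the variables still to be distributed among the inputs of the whole
    -- circuit, so that the recursion can pass to the remaining blocks.
    bottomGates : ∀ {I m n} → Blocks p m n → (Fin n → I) → Vec (Gate k I) (m ℕ.* (T ℕ.* 2))
    bottomGates []               ι = []
    bottomGates (block q {n = n} q≤p bs) ι =
      thresholdGates (Vec.tabulate (ι ∘ (_↑ˡ n))) (ℕ.≤-trans (ℕ.*-monoˡ-≤ 2 q≤p) 2p≤k) (thresholds d T) Vec.++
      bottomGates bs (ι ∘ (q ↑ʳ_))

    sum-bottomGates : ∀ {I m n} (bs : Blocks p m n) (ι : Fin n → I) (val : I → Bool) A → val ∘ ι ≗ Vec.lookup A →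
                      Vec.sum (Vec.map (λ g → bit (evalGate g val)) (bottomGates bs ι)) ≡ blockCrossings d T bs A
    sum-bottomGates [] ι val A eq = refl
    sum-bottomGates (block q {n = n} q≤p bs) ι val A eq = begin
      Vec.sum (Vec.map v (gs Vec.++ rest))                      ≡⟨ cong Vec.sum (Vec.map-++ v gs rest) ⟩
      Vec.sum (Vec.map v gs Vec.++ Vec.map v rest)              ≡⟨ Vec.sum-++ (Vec.map v gs) ⟩
      Vec.sum (Vec.map v gs) ℕ.+ Vec.sum (Vec.map v rest)
        ≡⟨ cong₂ ℕ._+_
             (sum-thresholdGates (Vec.tabulate (ι ∘ (_↑ˡ n))) _ (thresholds d T) val (take q A) inputs≡take)
             (sum-bottomGates bs (ι ∘ (q ↑ʳ_)) val (drop q A) (λ i → trans (eq (q ↑ʳ i)) (lookup-↑ʳ q A i))) ⟩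
      blockCrossings d T (block q q≤p bs) A                     ∎
      where
      open ≡-Reasoning
      v = λ g → bit (evalGate g val)
      gs = thresholdGates (Vec.tabulate (ι ∘ (_↑ˡ n))) (ℕ.≤-trans (ℕ.*-monoˡ-≤ 2 q≤p) 2p≤k) (thresholds d T)
      rest = bottomGates bs (ι ∘ (q ↑ʳ_))
      lookup-↑ˡ : ∀ q {n} (A : Vec Bool (q ℕ.+ n)) i → Vec.lookup A (i ↑ˡ n) ≡ Vec.lookup (take q A) i
      lookup-↑ˡ (suc q) (b ∷ A) fzero    = refl
      lookup-↑ˡ (suc q) (b ∷ A) (fsuc i) = lookup-↑ˡ q A i
      lookup-↑ʳ : ∀ q {n} (A : Vec Bool (q ℕ.+ n)) i → Vec.lookup A (q ↑ʳ i) ≡ Vec.lookup (drop q A) i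
      lookup-↑ʳ zero    A       i = refl
      lookup-↑ʳ (suc q) (b ∷ A) i = lookup-↑ʳ q A i
      inputs≡take : Vec.map val (Vec.tabulate (ι ∘ (_↑ˡ n))) ≡ take q A
      inputs≡take = begin
        Vec.map val (Vec.tabulate (ι ∘ (_↑ˡ n)))      ≡⟨ Vec.tabulate-∘ val (ι ∘ (_↑ˡ n)) ⟨
        Vec.tabulate (val ∘ ι ∘ (_↑ˡ n))              ≡⟨ Vec.tabulate-cong (λ i → trans (eq (i ↑ˡ n)) (lookup-↑ˡ q A i)) ⟩
        Vec.tabulate (Vec.lookup (take q A))          ≡⟨ Vec.tabulate∘lookup (take q A) ⟩
        take q A                                      ∎

    -- There are m · 2T bottom gates, each of weight 2 at the top; `size` bounds this total. The
    -- doubled threshold 2mT asks whether at least mT of them fire, that is, whether the sum of the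
    -- rounded excesses is nonnegative.
    circuit : ∀ {m n} → m ℕ.* (T ℕ.* 2) ℕ.* 2 ℕ.≤ k → Blocks p m n → MAJ∘MAJ k n
    circuit {m} size bs = doubledGate (bottomGates bs id) size (+ (2 ℕ.* (m ℕ.* T)))

    eval-circuit : ∀ {m n} (size : m ℕ.* (T ℕ.* 2) ℕ.* 2 ℕ.≤ k) (bs : Blocks p m n) A →
                   eval (circuit size bs) A ≡ ⌊ 0ℤ ≤? + blockCrossings d T bs A - + (m ℕ.* T) ⌋
    eval-circuit {m} size bs A = begin
      eval (circuit size bs) A
        ≡⟨ evalGate-doubled (bottomGates bs id) size (+ (2 ℕ.* (m ℕ.* T))) (λ g → evalGate g (Vec.lookup A)) ⟩
      ⌊ + (2 ℕ.* (m ℕ.* T)) ≤? + (2 ℕ.* Vec.sum (Vec.map (λ g → bit (evalGate g (Vec.lookup A))) (bottomGates bs id))) ⌋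
        ≡⟨ cong (λ y → ⌊ + (2 ℕ.* (m ℕ.* T)) ≤? + (2 ℕ.* y) ⌋) (sum-bottomGates bs id (Vec.lookup A) A (λ _ → refl)) ⟩
      ⌊ + (2 ℕ.* (m ℕ.* T)) ≤? + (2 ℕ.* blockCrossings d T bs A) ⌋
        ≡⟨ ⌊⌋-⇔ (mk⇔ (λ le → ℤ.i≤j⇒0≤j-i {+ (m ℕ.* T)} {+ blockCrossings d T bs A} (+≤+ (ℕ.*-cancelˡ-≤ 2 (ℤ.drop‿+≤+ le))))
                     (λ le → +≤+ (ℕ.*-monoʳ-≤ 2 (ℤ.drop‿+≤+ (ℤ.0≤i-j⇒j≤i {+ blockCrossings d T bs A} {+ (m ℕ.* T)} le))))) (_ ≤? _) (_ ≤? _) ⟩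
      ⌊ 0ℤ ≤? + blockCrossings d T bs A - + (m ℕ.* T) ⌋ ∎
      where open ≡-Reasoning

  MAJ≡⌊0≤excess⌋ : ∀ {n} (A : Vec Bool n) → MAJ A ≡ ⌊ 0ℤ ≤? excess A ⌋
  MAJ≡⌊0≤excess⌋ {n} A = ⌊⌋-⇔ (mk⇔ to from) (n ℕ.≤? 2 ℕ.* ones A) (0ℤ ≤? excess A)
    where
    e : ∀ n x → n + x - n ≡ x
    e = ℤ-Ring.solve-∀
    to : n ℕ.≤ 2 ℕ.* ones A → 0ℤ ≤ excess A
    to le = subst (0ℤ ≤_) (trans (cong (_- + n) (2ones≡n+excess A)) (e (+ n) (excess A))) (ℤ.i≤j⇒0≤j-i (+≤+ le))
    from : 0ℤ ≤ excess A → n ℕ.≤ 2 ℕ.* ones A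
    from le = ℤ.drop‿+≤+ (subst (+ n ≤_) (sym (2ones≡n+excess A)) (subst (_≤ + n + excess A) (ℤ.+-identityʳ (+ n)) (ℤ.+-monoʳ-≤ (+ n) le)))

  -- If g and x lay on different sides of 0, then h = x - dg would be at least as large as x in
  -- absolute value. The alternative h = 0 covers ties x = 0, where no strict inequality is
  -- possible.
  sign-stable : ∀ d {x h g} → 1 ℕ.≤ d → x ≡ h + + d * g → ∣ h ∣ ℕ.< ∣ x ∣ ⊎ h ≡ 0ℤ → ⌊ 0ℤ ≤? g ⌋ ≡ ⌊ 0ℤ ≤? x ⌋
  sign-stable d@(suc _) {x} {h} {g} _ eq small = ⌊⌋-⇔ (mk⇔ to from) (0ℤ ≤? g) (0ℤ ≤? x)
    where
    ∣∣-mono : ∀ {i j} → 0ℤ ≤ i → i ≤ j → ∣ i ∣ ℕ.≤ ∣ j ∣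
    ∣∣-mono (+≤+ _) (+≤+ i≤j) = i≤j
    ∣∣-antimono : ∀ {i j} → i ≤ j → j ≤ 0ℤ → ∣ j ∣ ℕ.≤ ∣ i ∣
    ∣∣-antimono {i} {j} i≤j j≤0 = subst₂ ℕ._≤_ (ℤ.∣-i∣≡∣i∣ j) (ℤ.∣-i∣≡∣i∣ i) (∣∣-mono (ℤ.neg-mono-≤ j≤0) (ℤ.neg-mono-≤ i≤j))
    to : 0ℤ ≤ g → 0ℤ ≤ x
    to 0≤g = ℤ.≮⇒≥ λ x<0 → Sum.[ (λ h<x → contradiction (∣∣-antimono h≤x (ℤ.<⇒≤ x<0)) (ℕ.<⇒≱ h<x))
                                     , (λ h≡0 → contradiction (subst (_≤ x) h≡0 h≤x) (ℤ.<⇒≱ x<0)) ] small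
      where
      h≤x : h ≤ x
      h≤x = subst₂ _≤_ (trans (cong (λ y → h + y) (ℤ.*-zeroʳ (+ d))) (ℤ.+-identityʳ h)) (sym eq)
              (ℤ.+-monoʳ-≤ h (ℤ.*-monoˡ-≤-nonNeg (+ d) 0≤g))
    from : 0ℤ ≤ x → 0ℤ ≤ g
    from 0≤x = ℤ.≮⇒≥ λ g<0 →
      let x<h = subst₂ _<_ (sym eq) (trans (cong (λ y → h + y) (ℤ.*-zeroʳ (+ d))) (ℤ.+-identityʳ h))
                  (ℤ.+-monoʳ-< h (ℤ.*-monoˡ-<-pos (+ d) g<0))
      in Sum.[ (λ h<x → contradiction (∣∣-mono 0≤x (ℤ.<⇒≤ x<h)) (ℕ.<⇒≱ h<x))
                  , (λ h≡0 → contradiction 0≤x (ℤ.<⇒≱ (subst (x <_) h≡0 x<h))) ] small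

  circuit-correct : ∀ d T {k p m n} (2p≤k : p ℕ.* 2 ℕ.≤ k) (size : m ℕ.* (T ℕ.* 2) ℕ.* 2 ℕ.≤ k) (bs : Blocks p m n) A → 1 ℕ.≤ d →
                    ∣ blockError d T bs A ∣ ℕ.< ∣ excess A ∣ ⊎ blockError d T bs A ≡ 0ℤ →
                    eval (circuit d T 2p≤k size bs) A ≡ MAJ A
  circuit-correct d T 2p≤k size bs A d≥1 small = trans (eval-circuit d T 2p≤k size bs A)
    (trans (sign-stable d d≥1 (excess≡error+steps d T bs A) small) (sym (MAJ≡⌊0≤excess⌋ A)))

-- Anticoncentration of the excess

module _ where
  open import Data.Integer using (+_; -_; _+_; _-_; _*_; _≤_; +≤+; 0ℤ; 1ℤ; ∣_∣)

  ∑-ones≡C : ∀ n k → ∑ {n} (λ A → ⟦ ⌊ ones A ℕ.≟ k ⌋ ⟧) ≡ + (n C k)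
  ∑-ones≡C zero zero = refl
  ∑-ones≡C zero (suc k) = cong +_ (sym (k>n⇒nCk≡0 {0} {suc k} (ℕ.s≤s ℕ.z≤n)))
  ∑-ones≡C (suc n) zero = cong₂ _+_ (∑-ones≡C n zero) (trans (∑-const n 0ℤ) (ℤ.*-zeroʳ (+ (2 ℕ.^ n))))
  ∑-ones≡C (suc n) (suc k) = trans (cong₂ _+_ (∑-ones≡C n (suc k)) (trans (∑-cong n shift) (∑-ones≡C n k)))
    (cong +_ (trans (ℕ.+-comm (n C suc k) (n C k)) (nCk+nC[k+1]≡[n+1]C[k+1] n k)))
    where
    shift : ∀ A → ⟦ ⌊ suc (ones A) ℕ.≟ suc k ⌋ ⟧ ≡ ⟦ ⌊ ones A ℕ.≟ k ⌋ ⟧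
    shift A = cong ⟦_⟧ (⌊⌋-⇔ (mk⇔ ℕ.suc-injective (cong suc)) (suc (ones A) ℕ.≟ suc k) (ones A ℕ.≟ k))

  -- The right-hand side of a union bound over the values g 0, ..., g (ℓ - 1); repeated values count
  -- with multiplicity.
  hits : ∀ {n} → (ℕ → ℕ) → ℕ → Vec Bool n → ℤ
  hits g zero    A = 0ℤ
  hits g (suc ℓ) A = ⟦ ⌊ ones A ℕ.≟ g ℓ ⌋ ⟧ + hits g ℓ A

  0≤⟦_⟧ : ∀ b → 0ℤ ≤ ⟦ b ⟧
  0≤⟦ b ⟧ = +≤+ ℕ.z≤n

  0≤hits : ∀ {n} g ℓ (A : Vec Bool n) → 0ℤ ≤ hits g ℓ A
  0≤hits g zero    A = ℤ.≤-refl
  0≤hits g (suc ℓ) A = ℤ.+-mono-≤ (0≤⟦ ⌊ ones A ℕ.≟ g ℓ ⌋ ⟧) (0≤hits g ℓ A)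

  1≤hits : ∀ {n} g {j ℓ} (A : Vec Bool n) → j ℕ.< ℓ → ones A ≡ g j → 1ℤ ≤ hits g ℓ A
  1≤hits g {j} {suc ℓ} A (ℕ.s≤s j≤ℓ) eq with ℕ.m≤n⇒m<n∨m≡n j≤ℓ
  ... | inj₁ j<ℓ  = ℤ.+-mono-≤ (0≤⟦ ⌊ ones A ℕ.≟ g ℓ ⌋ ⟧) (1≤hits g A j<ℓ eq)
  ... | inj₂ refl = ℤ.+-mono-≤ (ℤ.≤-reflexive (sym (bit-yes (ones A ℕ.≟ g ℓ) eq))) (0≤hits g ℓ A)

  ∑-hits : ∀ n s g ℓ → s ℕ.* s ℕ.≤ n → + s * ∑ {n} (hits g ℓ) ≤ + ℓ * + (2 ℕ.^ n)
  ∑-hits n s g zero    s² = ℤ.≤-reflexive (trans (cong (λ y → + s * y) (trans (∑-const n 0ℤ) (ℤ.*-zeroʳ (+ (2 ℕ.^ n))))) (ℤ.*-zeroʳ (+ s)))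
  ∑-hits n s g (suc ℓ) s² = begin
    + s * ∑ {n} (λ A → ⟦ ⌊ ones A ℕ.≟ g ℓ ⌋ ⟧ + hits g ℓ A)
      ≡⟨ cong (λ y → + s * y) (trans (∑-+ n (λ A → ⟦ ⌊ ones A ℕ.≟ g ℓ ⌋ ⟧) (hits g ℓ)) (cong (λ y → y + ∑ {n} (hits g ℓ)) (∑-ones≡C n (g ℓ)))) ⟩
    + s * (+ (n C g ℓ) + ∑ {n} (hits g ℓ))
      ≡⟨ ℤ.*-distribˡ-+ (+ s) (+ (n C g ℓ)) (∑ {n} (hits g ℓ)) ⟩
    + s * + (n C g ℓ) + + s * ∑ {n} (hits g ℓ)
      ≤⟨ ℤ.+-mono-≤ (subst (_≤ + (2 ℕ.^ n)) (ℤ.pos-* s (n C g ℓ)) (+≤+ (C-anticoncentration n (g ℓ) s s²))) (∑-hits n s g ℓ s²) ⟩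
    + (2 ℕ.^ n) + + ℓ * + (2 ℕ.^ n)
      ≡⟨ e (+ ℓ) (+ (2 ℕ.^ n)) ⟩
    + suc ℓ * + (2 ℕ.^ n) ∎
    where
    open ℤ.≤-Reasoning
    e : ∀ ℓ q → q + ℓ * q ≡ (1ℤ + ℓ) * q
    e = ℤ-Ring.solve-∀

  -- The witness is j = excess + L, so that n + j - L = n + excess is twice the number of ones. For
  -- a negative excess, ∣ excess ∣ < L makes the truncated subtraction in the witness exact.
  small-excess⇒ones : ∀ {n} L (A : Vec Bool n) → ∣ excess A ∣ ℕ.< L → ∃[ j ] j ℕ.< 2 ℕ.* L × ones A ≡ (n ℕ.+ j ℕ.∸ L) / 2
  small-excess⇒ones {n} L A small = locate (excess A) (2ones≡n+excess A) small
    where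
    halve : ∀ {t} → t ≡ 2 ℕ.* ones A → ones A ≡ t / 2
    halve refl = sym (trans (cong (_/ 2) (ℕ.*-comm 2 (ones A))) (m*n/n≡m (ones A) 2))
    locate : ∀ x → + (2 ℕ.* ones A) ≡ + n + x → ∣ x ∣ ℕ.< L → ∃[ j ] j ℕ.< 2 ℕ.* L × ones A ≡ (n ℕ.+ j ℕ.∸ L) / 2
    locate (+ a) eq a<L = a ℕ.+ L , j< , halve (begin
      n ℕ.+ (a ℕ.+ L) ℕ.∸ L      ≡⟨ cong (ℕ._∸ L) (ℕ.+-assoc n a L) ⟨
      n ℕ.+ a ℕ.+ L ℕ.∸ L        ≡⟨ ℕ.m+n∸n≡m (n ℕ.+ a) L ⟩
      n ℕ.+ a                    ≡⟨ ℤ.+-injective eq ⟨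
      2 ℕ.* ones A               ∎)
      where
      open ≡-Reasoning
      j< : a ℕ.+ L ℕ.< 2 ℕ.* L
      j< = subst (a ℕ.+ L ℕ.<_) (cong (L ℕ.+_) (sym (ℕ.+-identityʳ L))) (ℕ.+-monoˡ-< L a<L)
    locate ℤ.-[1+ a ] eq a<L = L ℕ.∸ suc a , ℕ.<-≤-trans (ℕ.∸-monoʳ-< (ℕ.s≤s ℕ.z≤n) (ℕ.<⇒≤ a<L)) (ℕ.m≤m+n L _) , halve (begin
      n ℕ.+ (L ℕ.∸ suc a) ℕ.∸ L                          ≡⟨ cong (λ y → y ℕ.+ (L ℕ.∸ suc a) ℕ.∸ L) n≡ ⟩
      2 ℕ.* ones A ℕ.+ suc a ℕ.+ (L ℕ.∸ suc a) ℕ.∸ L     ≡⟨ cong (ℕ._∸ L) (ℕ.+-assoc (2 ℕ.* ones A) (suc a) _) ⟩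
      2 ℕ.* ones A ℕ.+ (suc a ℕ.+ (L ℕ.∸ suc a)) ℕ.∸ L   ≡⟨ cong (λ y → 2 ℕ.* ones A ℕ.+ y ℕ.∸ L) (ℕ.m+[n∸m]≡n (ℕ.<⇒≤ a<L)) ⟩
      2 ℕ.* ones A ℕ.+ L ℕ.∸ L                           ≡⟨ ℕ.m+n∸n≡m (2 ℕ.* ones A) L ⟩
      2 ℕ.* ones A                                       ∎)
      where
      open ≡-Reasoning
      e : ∀ n y → n + - y + y ≡ n
      e = ℤ-Ring.solve-∀
      n≡ : n ≡ 2 ℕ.* ones A ℕ.+ suc a
      n≡ = sym (ℤ.+-injective (trans (cong (λ y → y + + suc a) eq) (e (+ n) (+ suc a))))

  -- A union bound over 2L candidate values for the number of ones, each attained at most 2ⁿ/s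
  -- times.
  excess-anticoncentration : ∀ n s L → s ℕ.* s ℕ.≤ n →
    + s * ∑ {n} (λ A → ⟦ ⌊ ∣ excess A ∣ ℕ.<? L ⌋ ⟧) ≤ + (2 ℕ.* L) * + (2 ℕ.^ n)
  excess-anticoncentration n s L s² = ℤ.≤-trans
    (ℤ.*-monoˡ-≤-nonNeg (+ s) (∑-mono n (λ A → covered A (∣ excess A ∣ ℕ.<? L))))
    (∑-hits n s g (2 ℕ.* L) s²)
    where
    g : ℕ → ℕ
    g j = (n ℕ.+ j ℕ.∸ L) / 2
    covered : ∀ A → (dec : Dec (∣ excess A ∣ ℕ.< L)) → ⟦ ⌊ dec ⌋ ⟧ ≤ hits g (2 ℕ.* L) A
    covered A (no _)      = 0≤hits g (2 ℕ.* L) A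
    covered A (yes small) with j , j< , eq ← small-excess⇒ones L A small = 1≤hits g A j< eq

-- Disagreements with MAJ

module _ (d T : ℕ) {k p m n : ℕ} (2p≤k : p ℕ.* 2 ℕ.≤ k) (size : m ℕ.* (T ℕ.* 2) ℕ.* 2 ℕ.≤ k) (bs : Blocks p m n) where
  open import Data.Integer using (+_; -_; _+_; _*_; _≤_; _<_; +≤+; 0ℤ; 1ℤ; ∣_∣; _≤?_)

  private
    f : Vec Bool n → Bool
    f = eval (circuit d T 2p≤k size bs)

  agreements-exact : 1 ℕ.≤ d → (∀ A → blockError d T bs A ≡ 0ℤ) → agreements f MAJ ≡ 2 ℕ.^ n
  agreements-exact d≥1 exact = ℤ.+-injective (begin
    + agreements f MAJ                          ≡⟨ length-filter-cube (λ A → f A Bool.≟ MAJ A) ⟩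
    ∑ (λ A → ⟦ ⌊ f A Bool.≟ MAJ A ⌋ ⟧)          ≡⟨ ∑-cong n (λ A → bit-yes (f A Bool.≟ MAJ A) (circuit-correct d T 2p≤k size bs A d≥1 (inj₂ (exact A)))) ⟩
    ∑ {n} (λ _ → 1ℤ)                            ≡⟨ ∑-const n 1ℤ ⟩
    + (2 ℕ.^ n) * 1ℤ                            ≡⟨ ℤ.*-identityʳ (+ (2 ℕ.^ n)) ⟩
    + (2 ℕ.^ n)                                 ∎)
    where open ≡-Reasoning

  -- A disagreement forces ∣ blockError ∣ ≥ ∣ excess ∣, so either ∣ excess ∣ < L or blockError² ≥ L².
  chebyshev-pointwise : 1 ℕ.≤ d → ∀ L A → let H = blockError d T bs A in
    + (L ℕ.* L) ≤ + (L ℕ.* L) * ⟦ ⌊ f A Bool.≟ MAJ A ⌋ ⟧ + (+ (L ℕ.* L) * ⟦ ⌊ ∣ excess A ∣ ℕ.<? L ⌋ ⟧ + H * H)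
  chebyshev-pointwise d≥1 L A = subst (+ (L ℕ.* L) ≤_) cast (+≤+ (cases (f A Bool.≟ MAJ A) (∣ excess A ∣ ℕ.<? L)))
    where
    H = blockError d T bs A
    cast : ∀ {b c} → + (L ℕ.* L ℕ.* bit b ℕ.+ (L ℕ.* L ℕ.* bit c ℕ.+ ∣ H ∣ ℕ.* ∣ H ∣)) ≡ + (L ℕ.* L) * ⟦ b ⟧ + (+ (L ℕ.* L) * ⟦ c ⟧ + H * H)
    cast {b} {c} = cong₂ _+_ (ℤ.pos-* (L ℕ.* L) (bit b)) (cong₂ _+_ (ℤ.pos-* (L ℕ.* L) (bit c)) (sym (square H)))
    cases : (agree : Dec (f A ≡ MAJ A)) (small : Dec (∣ excess A ∣ ℕ.< L)) →
            L ℕ.* L ℕ.≤ L ℕ.* L ℕ.* bit ⌊ agree ⌋ ℕ.+ (L ℕ.* L ℕ.* bit ⌊ small ⌋ ℕ.+ ∣ H ∣ ℕ.* ∣ H ∣)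
    cases (yes _) small = ℕ.≤-trans (ℕ.≤-reflexive (sym (ℕ.*-identityʳ (L ℕ.* L)))) (ℕ.m≤m+n _ _)
    cases (no _) (yes _) = ℕ.≤-trans (ℕ.≤-reflexive (sym (ℕ.*-identityʳ (L ℕ.* L)))) (ℕ.≤-trans (ℕ.m≤m+n _ _) (ℕ.m≤n+m _ (L ℕ.* L ℕ.* 0)))
    cases (no f≢) (no large) = ℕ.≤-trans (ℕ.*-mono-≤ L≤H L≤H) (ℕ.≤-trans (ℕ.m≤n+m _ (L ℕ.* L ℕ.* 0)) (ℕ.m≤n+m _ (L ℕ.* L ℕ.* 0)))
      where
      L≤H : L ℕ.≤ ∣ H ∣
      L≤H = ℕ.≤-trans (ℕ.≮⇒≥ large) (ℕ.≮⇒≥ λ H< → f≢ (circuit-correct d T 2p≤k size bs A d≥1 (inj₁ H<)))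

  -- The pointwise inequality summed over the cube, with the second moment bounded by
  -- `∑-blockError²`. The count `S` is produced as a natural number so that the remaining estimates
  -- take place in ℕ.
  chebyshev : 1 ℕ.≤ d → 1 ℕ.≤ T → p ≡ T ℕ.* (d ℕ.* d) → ∀ L →
    ∃[ S ] ∑ {n} (λ A → ⟦ ⌊ ∣ excess A ∣ ℕ.<? L ⌋ ⟧) ≡ + S ×
           2 ℕ.^ n ℕ.* (L ℕ.* L) ℕ.≤ L ℕ.* L ℕ.* agreements f MAJ ℕ.+ (L ℕ.* L ℕ.* S ℕ.+ m ℕ.* (4 ℕ.* (d ℕ.* d) ℕ.* 2 ℕ.^ n))
  chebyshev d≥1 T≥1 p≡ L = S , sym S≡ , ℤ.drop‿+≤+ (begin
    + (2 ℕ.^ n ℕ.* L²)                                              ≡⟨ trans (ℤ.pos-* (2 ℕ.^ n) L²) (sym (∑-const n (+ L²))) ⟩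
    ∑ {n} (λ _ → + L²)                                              ≤⟨ ∑-mono n (chebyshev-pointwise d≥1 L) ⟩
    ∑ (λ A → + L² * agree A + (+ L² * small A + H² A))              ≡⟨ trans (∑-+ n _ _) (cong₂ _+_ (∑-* n (+ L²) agree) (trans (∑-+ n _ H²) (cong (λ y → y + ∑ H²) (∑-* n (+ L²) small)))) ⟩
    + L² * ∑ agree + (+ L² * ∑ small + ∑ H²)                        ≡⟨ cong₂ (λ y z → + L² * y + (+ L² * z + ∑ H²)) (length-filter-cube (λ A → f A Bool.≟ MAJ A)) S≡ ⟨
    + L² * + a + (+ L² * + S + ∑ H²)                                ≤⟨ ℤ.+-monoʳ-≤ (+ L² * + a) (ℤ.+-monoʳ-≤ (+ L² * + S) (∑-blockError² d T d≥1 T≥1 p≡ bs)) ⟩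
    + L² * + a + (+ L² * + S + + m * (+ (4 ℕ.* (d ℕ.* d)) * + (2 ℕ.^ n)))
      ≡⟨ cong₂ _+_ (ℤ.pos-* L² a) (cong₂ _+_ (ℤ.pos-* L² S) (trans (ℤ.pos-* m _) (cong (λ y → + m * y) (ℤ.pos-* (4 ℕ.* (d ℕ.* d)) (2 ℕ.^ n))))) ⟨
    + (L² ℕ.* a ℕ.+ (L² ℕ.* S ℕ.+ m ℕ.* (4 ℕ.* (d ℕ.* d) ℕ.* 2 ℕ.^ n))) ∎)
    where
    open ℤ.≤-Reasoning
    L² = L ℕ.* L
    a = agreements f MAJ
    agree small H² : Vec Bool n → ℤ
    agree A = ⟦ ⌊ f A Bool.≟ MAJ A ⌋ ⟧
    small A = ⟦ ⌊ ∣ excess A ∣ ℕ.<? L ⌋ ⟧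
    H² A = blockError d T bs A * blockError d T bs A
    S = List.length (List.filter (λ (A : Vec Bool n) → ∣ excess A ∣ ℕ.<? L) (cube n))
    S≡ = length-filter-cube (λ (A : Vec Bool n) → ∣ excess A ∣ ℕ.<? L)

-- Choice of the parameters

module _ where
  open import Data.Nat using (_+_; _*_; _^_; _≤_; _<_; s≤s; z≤n; >-nonZero)
  open import Data.Nat.Properties

  -- With T = a⁴, L = a³ d², m = T d² the two exceptional events have density O(1/a).
  disagreement-bound : ∀ e d s Q agr S → let a = 12 * suc e; T = a * a * (a * a); L = a * a * a * (suc d * suc d) in
    T * (suc d * suc d) ≤ 4 * s → s * S ≤ 2 * L * Q →
    Q * (L * L) ≤ L * L * agr + (L * L * S + T * (suc d * suc d) * (4 * (suc d * suc d) * Q)) →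
    suc e * Q ≤ suc e * agr + Q
  disagreement-bound e d s Q agr S s-large S-small bound =
    *-cancelˡ-≤ 12 (*-cancelˡ-≤ a (*-cancelˡ-≤ (a * a * (a * a) * (D * D)) (begin
      a * a * (a * a) * (D * D) * (a * (12 * (suc e * Q)))
        ≡⟨ e₁ a D (suc e) Q ⟩
      a * a * (a * a) * (D * D) * (12 * suc e * (a * Q))
        ≡⟨ e₂ a D Q ⟩
      Q * (L * L)
        ≤⟨ bound ⟩
      L * L * agr + (L * L * S + T * D * (4 * D * Q))
        ≡⟨ e₃ a D Q agr S ⟩
      a * a * (a * a) * (D * D) * (a * (a * agr) + (a * (a * S) + 4 * Q))
        ≤⟨ *-monoʳ-≤ (a * a * (a * a) * (D * D)) (+-monoʳ-≤ (a * (a * agr)) (+-mono-≤ (*-monoʳ-≤ a aS≤8Q) (m≤n*m (4 * Q) a))) ⟩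
      a * a * (a * a) * (D * D) * (a * (a * agr) + (a * (8 * Q) + a * (4 * Q)))
        ≡⟨ cong (a * a * (a * a) * (D * D) *_) (e₄ (suc e) Q agr) ⟩
      a * a * (a * a) * (D * D) * (a * (12 * (suc e * agr + Q))) ∎)))
    where
    open ≤-Reasoning
    -- 12 = 8 + 4: the event of small excess has density at most 8/a, the event of large error at
    -- most 4/a² ≤ 4/a, and 12/a = 1/(e + 1).
    a = 12 * suc e
    D = suc d * suc d
    T = a * a * (a * a)
    L = a * a * a * D
    e₀ : ∀ a D S → a * a * a * D * (a * S) ≡ a * a * (a * a) * D * S
    e₀ = ℕ-Ring.solve-∀
    e₀′ : ∀ L Q → 4 * (2 * L * Q) ≡ L * (8 * Q)
    e₀′ = ℕ-Ring.solve-∀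
    e₁ : ∀ a D e Q → a * a * (a * a) * (D * D) * (a * (12 * (e * Q))) ≡ a * a * (a * a) * (D * D) * (12 * e * (a * Q))
    e₁ = ℕ-Ring.solve-∀
    e₂ : ∀ a D Q → a * a * (a * a) * (D * D) * (a * (a * Q)) ≡ Q * (a * a * a * D * (a * a * a * D))
    e₂ = ℕ-Ring.solve-∀
    e₃ : ∀ a D Q agr S → a * a * a * D * (a * a * a * D) * agr + (a * a * a * D * (a * a * a * D) * S + a * a * (a * a) * D * (4 * D * Q))
                       ≡ a * a * (a * a) * (D * D) * (a * (a * agr) + (a * (a * S) + 4 * Q))
    e₃ = ℕ-Ring.solve-∀
    e₄ : ∀ e Q agr → 12 * e * (12 * e * agr) + (12 * e * (8 * Q) + 12 * e * (4 * Q)) ≡ 12 * e * (12 * (e * agr + Q))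
    e₄ = ℕ-Ring.solve-∀
    -- As TD = aL, the chain is a L S = T D S ≤ 4 s S ≤ 8 L Q, and `L` cancels.
    aS≤8Q : a * S ≤ 8 * Q
    aS≤8Q = *-cancelˡ-≤ L (begin
      L * (a * S)         ≡⟨ e₀ a D S ⟩
      T * D * S           ≤⟨ *-monoˡ-≤ S s-large ⟩
      4 * s * S           ≡⟨ *-assoc 4 s S ⟩
      4 * (s * S)         ≤⟨ *-monoʳ-≤ 4 S-small ⟩
      4 * (2 * L * Q)     ≡⟨ e₀′ L Q ⟩
      L * (8 * Q)         ∎)

  -- A downward search for a place where f crosses n. Applied to r ↦ (Tr²)², it brackets √n between
  -- consecutive candidate block sizes, unless it runs down to r = 0.
  least-suc : ∀ (f : ℕ → ℕ) n b → n ≤ f (suc b) → ∃[ r ] n ≤ f (suc r) × (r ≡ 0 ⊎ f r < n)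
  least-suc f n zero    n≤ = 0 , n≤ , inj₁ refl
  least-suc f n (suc b) n≤ with n ≤? f (suc b)
  ... | yes n≤′ = least-suc f n b n≤′
  ... | no n≰   = suc b , n≤ , inj₂ (≰⇒> n≰)

  -- The goal for ε = 1/(e + 1) and a natural constant `c`, cleared of denominators and square
  -- roots.
  Approximation : (e c n : ℕ) → Set
  Approximation e c n = Σ[ k ∈ ℕ ] (1 ≤ k × k * k ≤ c * c * n ×
    Σ[ C ∈ MAJ∘MAJ k n ] suc e * 2 ^ n ≤ suc e * agreements (eval C) MAJ + 2 ^ n)

  approximation : ∀ e → Σ[ c ∈ ℕ ] (1 ≤ c × (∀ n → 1 ≤ n → Approximation e c n))
  -- The circuit has k = 4TP with P² ≤ 16T²n, hence k² = 16T²P² ≤ (16T²)² n.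
  approximation e = 16 * (T * T) , *-mono-≤ {1} {16} (s≤s z≤n) (*-mono-≤ T≥1 T≥1) ,
    λ n n≥1 → build n n≥1 (least-suc (λ r → p r * p r) n n (n≤p² n))
    where
    a = 12 * suc e
    T = a * a * (a * a)
    T≥1 : 1 ≤ T
    T≥1 = s≤s z≤n
    p : ℕ → ℕ
    p r = T * (r * r)
    n≤p² : ∀ n → n ≤ p (suc n) * p (suc n)
    n≤p² n = ≤-trans (n≤1+n n) (≤-trans n<p (m≤m*n (p (suc n)) (p (suc n)) ⦃ >-nonZero (≤-trans (s≤s z≤n) n<p) ⦄))
      where
      n<p : n < p (suc n)
      n<p = ≤-trans (m≤m*n (suc n) (suc n)) (m≤n*m (suc n * suc n) T)
    module _ (n : ℕ) (n≥1 : 1 ≤ n) (r : ℕ) (n≤ : n ≤ p (suc r) * p (suc r)) where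
      P = p (suc r)
      -- `P` is both the block size and the number of blocks. The top gate has exactly this total
      -- weight: P blocks, 2T gates per block, weight 2 each.
      k = P * (T * 2) * 2
      L = a * a * a * (suc r * suc r)
      2P≤k : P * 2 ≤ k
      2P≤k = *-monoˡ-≤ 2 (m≤m*n P (T * 2))
      bs = blocks P P n n≤
      C = circuit (suc r) T 2P≤k ≤-refl bs
      k≥1 : 1 ≤ k
      k≥1 = s≤s z≤n
      k-bound : P * P ≤ 16 * (T * T) * n → k * k ≤ 16 * (T * T) * (16 * (T * T)) * n
      k-bound P² = begin
        k * k                                         ≡⟨ e₁ P T ⟩
        16 * (T * T) * (P * P)                        ≤⟨ *-monoʳ-≤ (16 * (T * T)) P² ⟩
        16 * (T * T) * (16 * (T * T) * n)             ≡⟨ *-assoc (16 * (T * T)) (16 * (T * T)) n ⟨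
        16 * (T * T) * (16 * (T * T)) * n             ∎
        where
        open ≤-Reasoning
        e₁ : ∀ P T → P * (T * 2) * 2 * (P * (T * 2) * 2) ≡ 16 * (T * T) * (P * P)
        e₁ = ℕ-Ring.solve-∀
    build : ∀ n → 1 ≤ n → ∃[ r ] n ≤ p (suc r) * p (suc r) × (r ≡ 0 ⊎ p r * p r < n) →
            Approximation e (16 * (T * T)) n
    -- Small n: here d = 1 and P = T, so the circuit computes `MAJ` exactly.
    build n n≥1 (zero , n≤ , _) =
      k n n≥1 0 n≤ , k≥1 n n≥1 0 n≤ , k-bound n n≥1 0 n≤ P² , C n n≥1 0 n≤ , ≤-trans (≤-reflexive (cong (suc e *_) (sym exact))) (m≤m+n _ (2 ^ n))
      where
      P² : p 1 * p 1 ≤ 16 * (T * T) * n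
      P² = ≤-trans (≤-reflexive (cong (λ t → t * t) (*-identityʳ T))) (≤-trans (m≤n*m (T * T) 16) (m≤m*n (16 * (T * T)) n ⦃ >-nonZero n≥1 ⦄))
      exact : agreements (eval (C n n≥1 0 n≤)) MAJ ≡ 2 ^ n
      exact = agreements-exact 1 T (2P≤k n n≥1 0 n≤) ≤-refl (bs n n≥1 0 n≤) ≤-refl
        (λ A → blockError-exact T (bs n n≥1 0 n≤) A (≤-reflexive (*-identityʳ T)))
    build n n≥1 (suc r , n≤ , inj₂ s²<n) =
      k n n≥1 (suc r) n≤ , k≥1 n n≥1 (suc r) n≤ , k-bound n n≥1 (suc r) n≤ P² , C n n≥1 (suc r) n≤ , conclude
        (chebyshev (suc (suc r)) T (2P≤k n n≥1 (suc r) n≤) ≤-refl (bs n n≥1 (suc r) n≤) (s≤s z≤n) T≥1 refl Λ)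
      where
      -- The preceding candidate, which the search found to satisfy s² < n, replaces √n in the
      -- anticoncentration bound. Since r + 2 ≤ 2(r + 1), the actual block size is at most 4s.
      s = p (suc r)
      Λ = L n n≥1 (suc r) n≤
      P≤4s : p (suc (suc r)) ≤ 4 * s
      P≤4s = begin
        T * (suc (suc r) * suc (suc r))                        ≤⟨ m≤m+n _ (T * (r * (3 * r + 4))) ⟩
        T * (suc (suc r) * suc (suc r)) + T * (r * (3 * r + 4)) ≡⟨ e₁ T r ⟩
        4 * (T * (suc r * suc r))                              ∎
        where
        open ≤-Reasoning
        e₁ : ∀ T r → T * (suc (suc r) * suc (suc r)) + T * (r * (3 * r + 4)) ≡ 4 * (T * (suc r * suc r))
        e₁ = ℕ-Ring.solve-∀
      P² : p (suc (suc r)) * p (suc (suc r)) ≤ 16 * (T * T) * n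
      P² = begin
        p (suc (suc r)) * p (suc (suc r))     ≤⟨ *-mono-≤ P≤4s P≤4s ⟩
        4 * s * (4 * s)                       ≡⟨ e₁ s ⟩
        16 * (s * s)                          ≤⟨ *-mono-≤ (m≤m*n 16 (T * T)) (<⇒≤ s²<n) ⟩
        16 * (T * T) * n                      ∎
        where
        open ≤-Reasoning
        e₁ : ∀ s → 4 * s * (4 * s) ≡ 16 * (s * s)
        e₁ = ℕ-Ring.solve-∀
      agr = agreements (eval (C n n≥1 (suc r) n≤)) MAJ
      conclude : (∃[ S ] ∑ {n} (λ A → ⟦ ⌊ ℤ.∣ excess A ∣ ℕ.<? Λ ⌋ ⟧) ≡ ℤ.+ S ×
                  2 ^ n * (Λ * Λ) ≤ Λ * Λ * agr + (Λ * Λ * S + p (suc (suc r)) * (4 * (suc (suc r) * suc (suc r)) * 2 ^ n))) →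
                 suc e * 2 ^ n ≤ suc e * agr + 2 ^ n
      conclude (S , S≡ , bound) = disagreement-bound e (suc r) s (2 ^ n) agr S P≤4s small bound
        where
        small : s * S ≤ 2 * Λ * 2 ^ n
        small = ℤ.drop‿+≤+ (subst₂ ℤ._≤_
          (trans (cong (λ y → ℤ.+ s ℤ.* y) S≡) (sym (ℤ.pos-* s S))) (sym (ℤ.pos-* (2 * Λ) (2 ^ n)))
          (excess-anticoncentration n s Λ (<⇒≤ s²<n)))

-- Translation to rational numbers

open import Data.Nat using (ℕ; _≤_)
open import Data.Rational using (ℚ; 0ℚ; 1ℚ; _-_) renaming (_<_ to _<ℚ_; _≤_ to _≤ℚ_)
open import Data.Product using (_×_; Σ-syntax)

-- In unnormalised rationals all the fractions involved have denominator 1, so the claim is the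
-- integer inequality itself.
≤·√-integer : ∀ k {c} n c′ → ℚ.toℚᵘ c′ ≡ ℚᵘ.mkℚᵘ (ℤ.+ c) 0 → k ℕ.* k ℕ.≤ c ℕ.* c ℕ.* n → k ≤ c′ ·√ n
≤·√-integer k {c} n c′ c′≡ k²≤ = ℚ.toℚᵘ-cancel-≤ (begin
  ℚ.toℚᵘ (ℤ.+ (k ℕ.* k) ℚ./ 1)                        ≃⟨ ℚ.toℚᵘ-fromℚᵘ (ℚᵘ.mkℚᵘ (ℤ.+ (k ℕ.* k)) 0) ⟩
  ℚᵘ.mkℚᵘ (ℤ.+ (k ℕ.* k)) 0                           ≤⟨ ℚᵘ.*≤* (subst₂ ℤ._≤_ lhs rhs (ℤ.+≤+ k²≤)) ⟩
  C ℚᵘ.* C ℚᵘ.* ℚᵘ.mkℚᵘ (ℤ.+ n) 0                     ≃⟨ ℚᵘ.*-cong (ℚᵘ.≃-sym c²) (ℚᵘ.≃-sym (ℚ.toℚᵘ-fromℚᵘ (ℚᵘ.mkℚᵘ (ℤ.+ n) 0))) ⟩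
  ℚ.toℚᵘ (c′ ℚ.* c′) ℚᵘ.* ℚ.toℚᵘ (ℤ.+ n ℚ./ 1)        ≃⟨ ℚ.toℚᵘ-homo-* (c′ ℚ.* c′) (ℤ.+ n ℚ./ 1) ⟨
  ℚ.toℚᵘ (c′ ℚ.* c′ ℚ.* (ℤ.+ n ℚ./ 1))                ∎)
  where
  open ℚᵘ.≤-Reasoning
  C = ℚᵘ.mkℚᵘ (ℤ.+ c) 0
  c² : ℚ.toℚᵘ (c′ ℚ.* c′) ℚᵘ.≃ C ℚᵘ.* C
  c² = ℚᵘ.≃-trans (ℚ.toℚᵘ-homo-* c′ c′) (ℚᵘ.≃-reflexive (cong₂ ℚᵘ._*_ c′≡ c′≡))
  lhs : ℤ.+ (k ℕ.* k) ≡ ℤ.+ (k ℕ.* k) ℤ.* ℤ.+ 1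
  lhs = sym (ℤ.*-identityʳ (ℤ.+ (k ℕ.* k)))
  rhs : ℤ.+ (c ℕ.* c ℕ.* n) ≡ ℤ.+ c ℤ.* ℤ.+ c ℤ.* ℤ.+ n ℤ.* ℤ.+ 1
  rhs = trans (ℤ.pos-* (c ℕ.* c) n) (trans (cong (ℤ._* ℤ.+ n) (ℤ.pos-* c c)) (sym (ℤ.*-identityʳ _)))

-- A positive ε has a numerator of at least 1, so ε ≥ 1/(e + 1) where e + 1 is its denominator.
-- Hence an agreement of at least 1 - 1/(e + 1) suffices.
1-ε≤fraction : ∀ ε → 0ℚ <ℚ ε → ∀ a Q .{{_ : ℕ.NonZero Q}} → suc (ℚ.denominator-1 ε) ℕ.* Q ℕ.≤ suc (ℚ.denominator-1 ε) ℕ.* a ℕ.+ Q →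
               1ℚ - ε ≤ℚ ℤ.+ a ℚ./ Q
1-ε≤fraction ε@(ℚ.mkℚ ℤ.+[1+ p ] e _) ε>0 a Q@(suc Q-1) bound = ℚ.toℚᵘ-cancel-≤ (begin
  ℚ.toℚᵘ (1ℚ - ε)                         ≃⟨ ℚᵘ.≃-trans (ℚ.toℚᵘ-homo-+ 1ℚ (ℚ.- ε)) (ℚᵘ.+-congʳ ℚᵘ.1ℚᵘ (ℚ.toℚᵘ-homo‿- ε)) ⟩
  ℚᵘ.1ℚᵘ ℚᵘ.- ℚᵘ.mkℚᵘ ℤ.+[1+ p ] e        ≤⟨ ℚᵘ.*≤* cross ⟩
  ℚᵘ.mkℚᵘ (ℤ.+ a) Q-1                     ≃⟨ ℚ.toℚᵘ-fromℚᵘ (ℚᵘ.mkℚᵘ (ℤ.+ a) Q-1) ⟨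
  ℚ.toℚᵘ (ℤ.+ a ℚ./ Q)                    ∎)
  where
  open ℚᵘ.≤-Reasoning
  E = ℤ.+ suc e
  cross : (ℤ.1ℤ ℤ.* E ℤ.+ ℤ.-[1+ p ] ℤ.* ℤ.1ℤ) ℤ.* ℤ.+ Q ℤ.≤ ℤ.+ a ℤ.* (ℤ.1ℤ ℤ.* E)
  expand : ∀ E p Q → (ℤ.1ℤ ℤ.* E ℤ.+ ℤ.- (ℤ.1ℤ ℤ.+ p) ℤ.* ℤ.1ℤ) ℤ.* Q ≡ E ℤ.* Q ℤ.- (ℤ.1ℤ ℤ.+ p) ℤ.* Q
  expand = ℤ-Ring.solve-∀
  collect : ∀ E a p Q → E ℤ.* a ℤ.+ Q ℤ.- (ℤ.1ℤ ℤ.+ p) ℤ.* Q ≡ a ℤ.* (ℤ.1ℤ ℤ.* E) ℤ.- p ℤ.* Q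
  collect = ℤ-Ring.solve-∀
  bound′ : E ℤ.* ℤ.+ Q ℤ.≤ E ℤ.* ℤ.+ a ℤ.+ ℤ.+ Q
  bound′ = subst₂ ℤ._≤_ (ℤ.pos-* (suc e) Q) (cong (ℤ._+ ℤ.+ Q) (ℤ.pos-* (suc e) a)) (ℤ.+≤+ bound)
  -- With ε = (p + 1)/(e + 1), subtract (p + 1)Q from both sides of `bound′`; the remaining -pQ on
  -- the right is at most 0 and is dropped.
  cross = subst₂ ℤ._≤_ (sym (expand E (ℤ.+ p) (ℤ.+ Q))) refl
      (ℤ.≤-trans (ℤ.+-monoˡ-≤ (ℤ.- (ℤ.+ suc p ℤ.* ℤ.+ Q)) bound′)
        (subst (ℤ._≤ ℤ.+ a ℤ.* (ℤ.1ℤ ℤ.* E)) (sym (collect E (ℤ.+ a) (ℤ.+ p) (ℤ.+ Q)))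
          (subst (λ y → ℤ.+ a ℤ.* (ℤ.1ℤ ℤ.* E) ℤ.- y ℤ.≤ ℤ.+ a ℤ.* (ℤ.1ℤ ℤ.* E)) (ℤ.pos-* p Q)
            (ℤ.i-j≤i (ℤ.+ a ℤ.* (ℤ.1ℤ ℤ.* E)) (ℤ.+ (p ℕ.* Q))))))
1-ε≤fraction (ℚ.mkℚ (ℤ.+ zero) _ _) (ℚ.*<* (ℤ.+<+ ()))
1-ε≤fraction (ℚ.mkℚ ℤ.-[1+ _ ] _ _) (ℚ.*<* ())

theorem6 : (ε : ℚ) → 0ℚ <ℚ ε →
    Σ[ c ∈ ℚ ] (0ℚ <ℚ c ×
    ((n : ℕ) → 1 ≤ n →
    Σ[ k ∈ ℕ ] (1 ≤ k × (k ≤ c ·√ n) ×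
    Σ[ C ∈ MAJ∘MAJ k n ] (1ℚ - ε ≤ℚ agreementFraction (eval C) MAJ))))
theorem6 ε ε>0 = rationalise (approximation (ℚ.denominator-1 ε))
  where
  rationalise : Σ[ c ∈ ℕ ] (1 ≤ c × (∀ n → 1 ≤ n → Approximation (ℚ.denominator-1 ε) c n)) →
                Σ[ c ∈ ℚ ] (0ℚ <ℚ c × (∀ n → 1 ≤ n →
                  Σ[ k ∈ ℕ ] (1 ≤ k × (k ≤ c ·√ n) × Σ[ C ∈ MAJ∘MAJ k n ] (1ℚ - ε ≤ℚ agreementFraction (eval C) MAJ))))
  rationalise (c@(suc _) , _ , approximate) = c′ , ℚ.*<* (ℤ.+<+ (ℕ.s≤s ℕ.z≤n)) , λ n n≥1 →
    let k , k≥1 , k²≤ , C , bound = approximate n n≥1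
    in k , k≥1 , ≤·√-integer k n c′ refl k²≤ , C , 1-ε≤fraction ε ε>0 (agreements (eval C) MAJ) (2 ℕ.^ n) {{ℕ.m^n≢0 2 n}} bound
    where
    -- Given directly in lowest terms, so that its unnormalised form is c over 1 by computation.
    c′ = ℚ.mkℚ (ℤ.+ c) 0 (Coprimality.sym (Coprimality.1-coprimeTo c))
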